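{- Let $\theta>1$ be real and let $n$ be a positive integer with $n>\log_2\theta$. Then exactly one of the following holds: (i) $M_\theta(n)=\left\lfloor \frac{n}{\log\theta}-\frac12\right\rfloor$ and $n\notin\mathcal A_\theta$; (ii) $M_\theta(n)=\left\lfloor \frac{n}{\log\theta}+\frac12\right\rfloor$ and $n\in\mathcal A_\theta$.
   Context: $\lfloor x\rfloor$ is the floor of $x$ and $\{x\}=x-\lfloor x\rfloor$ its fractional part; $\log$ is the natural logarithm. For real $\theta>1$ and positive integer $n$, $M_\theta(n)=\left\lfloor 1/\{\theta^{1/n}\}\right\rfloor$ and $M'_\theta(n)=\left\lfloor 1/(\theta^{1/n}-1)\right\rfloor$. The set of atypical numbers is $\mathcal A_\theta=\{n\in\mathbb N: M'_\theta(n)\neq \lfloor n/\log\theta-1/2\rfloor\}$, where $\mathbb N$ is the set of positive integers. -}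

module Defs where

open import Algebra.Bundles using (CommutativeRing)
import Algebra.Properties.Monoid.Mult as MonoidMult
import Algebra.Properties.Monoid.Sum as MonoidSum
import Algebra.Properties.Semiring.Exp as SemiringExp
open import Axiom.ExcludedMiddle using (ExcludedMiddle)
open import Data.Fin.Base using (toℕ)
open import Data.Integer.Base as ℤ using (ℤ; +_; -[1+_])
open import Data.Nat.Base as ℕ using (ℕ; _!)
open import Data.Product.Base using (Σ; ∃; _×_; _,_)
open import Data.Sum.Base using (_⊎_)
open import Level using (0ℓ; suc)
open import Relation.Binary.Core using (Rel)
open import Relation.Binary.Structures using (IsStrictTotalOrder)
import Relation.Binary.Construct.StrictToNonStrict as StrictToNonStrict
open import Relation.Binary.PropositionalEquality.Core using (_≢_)
open import Relation.Nullary.Decidable.Core using (yes; no)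
open import Relation.Nullary.Negation.Core using (¬_)
open import Relation.Unary using (Pred; _∈_; Satisfiable)

-- The real numbers, characterised as a complete ordered field: classically
-- this determines them up to unique isomorphism.
record RealField : Set (suc 0ℓ) where
  infix 4 _<_
  infix 8 _⁻¹
  field
    commutativeRing : CommutativeRing 0ℓ 0ℓ

  open CommutativeRing commutativeRing public

  field
    _<_                : Rel Carrier 0ℓ
    isStrictTotalOrder : IsStrictTotalOrder _≈_ _<_
    0<1                : 0# < 1#
    +-monoˡ-<          : ∀ z {x y} → x < y → x + z < y + z
    *-positive         : ∀ {x y} → 0# < x → 0# < y → 0# < x * y

    -- Inversion is total, but its value at zero is left unspecified.
    _⁻¹                : Carrier → Carrier
    ⁻¹-cong            : ∀ {x y} → x ≈ y → x ⁻¹ ≈ y ⁻¹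
    *-inverseʳ         : ∀ {x} → ¬ (x ≈ 0#) → x * x ⁻¹ ≈ 1#

  open StrictToNonStrict _≈_ _<_ public using (_≤_)

  UpperBound : Pred Carrier 0ℓ → Pred Carrier 0ℓ
  UpperBound S u = ∀ {x} → x ∈ S → x ≤ u

  field
    supremum : ∀ (S : Pred Carrier 0ℓ) → Satisfiable S → ∃ (UpperBound S) →
               ∃ λ s → UpperBound S s × (∀ {u} → UpperBound S u → s ≤ u)

ExactlyOne : Set → Set → Set
ExactlyOne P Q = (P × ¬ Q) ⊎ (Q × ¬ P)

module Analysis (em : ExcludedMiddle 0ℓ) (R : RealField) where

  open RealField R
  open SemiringExp semiring using (_^_)
  open MonoidMult +-monoid using () renaming (_×_ to _×ᴿ_)
  open MonoidSum +-monoid using (sum-syntax)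

  infixl 7 _/_
  _/_ : Carrier → Carrier → Carrier
  x / y = x * y ⁻¹

  fromℕ : ℕ → Carrier
  fromℕ n = n ×ᴿ 1#

  fromℤ : ℤ → Carrier
  fromℤ (+ n)    = fromℕ n
  fromℤ -[1+ n ] = - fromℕ (ℕ.suc n)

  ½ : Carrier
  ½ = 1# / fromℕ 2

  -- A value satisfying P if there is one, and the default d otherwise.
  -- Below, P always has at most one solution (up to _≈_), and has one on the
  -- domain where the function being defined is meaningful.
  choose : {A : Set} → A → Pred A 0ℓ → A
  choose d P with em {Σ _ P}
  ... | yes (x , _) = x
  ... | no _        = d

  IsFloor : Carrier → Pred ℤ 0ℓ
  IsFloor x k = fromℤ k ≤ x × x < fromℤ k + 1#

  ⌊_⌋ : Carrier → ℤ
  ⌊ x ⌋ = choose (+ 0) (IsFloor x)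

  frac : Carrier → Carrier
  frac x = x - fromℤ ⌊ x ⌋

  IsRoot : ℕ → Carrier → Pred Carrier 0ℓ
  IsRoot n x y = 0# < y × y ^ n ≈ x

  -- The positive n-th root x^(1/n), for x > 0 and n ≥ 1.
  root : ℕ → Carrier → Carrier
  root n x = choose 0# (IsRoot n x)

  infix 4 _⟶_
  _⟶_ : (ℕ → Carrier) → Carrier → Set
  u ⟶ l = ∀ ε → 0# < ε →
          ∃ λ N → ∀ m → N ℕ.≤ m → (l - ε < u m) × (u m < l + ε)

  expSum : Carrier → ℕ → Carrier
  expSum y m = ∑[ k < m ] (y ^ toℕ k / fromℕ (toℕ k !))

  -- IsLog x y says that exp y = x, with exp y = ∑ yᵏ / k!.
  IsLog : Carrier → Pred Carrier 0ℓ
  IsLog x y = expSum y ⟶ x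

  -- The natural logarithm, for x > 0.
  log : Carrier → Carrier
  log x = choose 0# (IsLog x)

  log₂ : Carrier → Carrier
  log₂ x = log x / log (fromℕ 2)

  M : Carrier → ℕ → ℤ
  M θ n = ⌊ 1# / frac (root n θ) ⌋

  M′ : Carrier → ℕ → ℤ
  M′ θ n = ⌊ 1# / (root n θ - 1#) ⌋

  𝒜 : Carrier → Pred ℕ 0ℓ
  𝒜 θ n = 0 ℕ.< n × M′ θ n ≢ ⌊ fromℕ n / log θ - ½ ⌋

{-# OPTIONS --safe #-}

-- Put x = log θ / n, so that θ^(1/n) = eˣ with x > 0, and eˣ < 2 because
-- n > log₂ θ. Hence ⌊θ^(1/n)⌋ = 1 and M θ n = M′ θ n = ⌊1/(eˣ - 1)⌋. Since
-- 1/x - 1/2 ≤ 1/(eˣ - 1) ≤ 1/x + 1/2, this floor is either ⌊1/x - 1/2⌋ or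
-- ⌊1/x - 1/2⌋ + 1 = ⌊1/x + 1/2⌋, and n is atypical exactly in the second case.
--
-- The exponential is handled through the suprema of its partial sums on x ≥ 0:
-- comparing triangular with square partial sums of the Cauchy product gives
-- exp (x + y) = exp x exp y, and the logarithm of θ > 1 is the supremum of the
-- y ≥ 0 with exp y ≤ θ. The same comparison shows exp y ≤ 1 for y ≤ 0, so
-- that any y whose exponential series converges to θ is positive.

module Submission where

open import Defs
open import Algebra.Bundles using (CommutativeRing)
import Algebra.Properties.CommutativeSemiring.Binomial as Binomial
import Algebra.Properties.Ring as RingProperties
import Algebra.Properties.AbelianGroup as AbelianGroupProperties
import Algebra.Properties.Semiring.Exp as SemiringExp
import Algebra.Properties.Semiring.Mult as SemiringMult
import Algebra.Properties.Semiring.Mult.TCOptimised as SemiringMult′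
import Algebra.Properties.Semiring.Sum as SemiringSum
import Algebra.Solver.Ring as RingSolver
open import Algebra.Solver.Ring.AlmostCommutativeRing
  using (fromCommutativeRing; _-Raw-AlmostCommutative⟶_)
open import Axiom.ExcludedMiddle using (ExcludedMiddle)
open import Data.Fin.Base using (toℕ)
import Data.Fin.Properties as Fin
open import Data.Integer.Base as ℤ using (ℤ; +_; -[1+_]; _⊖_)
import Data.Integer.Properties as ℤ
open import Data.Maybe.Base using (Maybe; just; nothing)
open import Data.Nat.Base as ℕ using (ℕ; zero; suc; _!; z≤n; s≤s)
open import Data.Nat.Combinatorics using (_C_; nCk≡n!/k![n-k]!; k![n∸k]!∣n!)
open import Data.Nat.DivMod using (m/n*n≡m)
import Data.Nat.Properties as ℕ
open import Data.Product.Base using (Σ; ∃; _×_; _,_; proj₁; proj₂)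
open import Data.Sum.Base using (_⊎_; inj₁; inj₂)
open import Level using (0ℓ)
open import Relation.Binary.Bundles using (StrictTotalOrder)
open import Relation.Binary.Definitions using (tri<; tri≈; tri>)
import Relation.Binary.Construct.StrictToNonStrict as StrictToNonStrict
import Relation.Binary.Reasoning.StrictPartialOrder as StrictReasoning
import Relation.Binary.Reasoning.Setoid as SetoidReasoning
open import Relation.Binary.PropositionalEquality.Core as ≡ using (_≡_)
open import Relation.Nullary.Decidable.Core using (yes; no)
open import Relation.Nullary.Negation.Core using (¬_; contradiction)
open import Relation.Unary using (Pred; _∈_; _∉_)

-- One inequality, (2 - x) exp x ≤ 2 + x, carries most of the analysis. It bounds the partial sums
-- for x ≤ 1, from which exp at larger arguments is obtained as a power. It keeps exp close to 1
-- near 0, which is the continuity that surjectivity needs. With denominators cleared, it is the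
-- bound 1/x - 1/2 ≤ 1/(exp x - 1).
--
-- The obstacle is `log`: `choose` may return any y, of either sign, whose series converges to θ,
-- whereas the partial sums are known to increase only for y ≥ 0. Constructing one logarithm is
-- therefore not enough. Candidates y ≤ 0 must be excluded without a theory of exp at negative
-- arguments. What makes this possible is that exp z - exp (- z) has nonnegative coefficients for z
-- ≥ 0, so its product with exp z still falls under the comparison of triangles with squares.

-- Ring solver with integer coefficients.

module IntegerCoefficientSolver (A : CommutativeRing 0ℓ 0ℓ) where

  open CommutativeRing A
  open RingProperties ring
    using (-‿distribˡ-*; -‿distribʳ-*; -0#≈0#; -‿involutive)
  open AbelianGroupProperties +-abelianGroup using (⁻¹-∙-comm)
  open SemiringMult′ semiring using (×1-homo-*; ×-homo-+; 1+×)
    renaming (_×_ to _×′_)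
  open SetoidReasoning setoid

  -- Equality on ℤ is decidable, unlike equality on the carrier, so the solver normalises with
  -- integer coefficients. With `_×′_` the constants 1 and 2 evaluate to `1#` and `1# + 1#`, with no
  -- trailing `0#`. The numeral `fromℕ 2` does have one, so it is spelled out in solver calls.
  fromInteger : ℤ → Carrier
  fromInteger (+ n)    = n ×′ 1#
  fromInteger -[1+ n ] = - (suc n ×′ 1#)

  fromInteger-⊖ : ∀ m n → fromInteger (m ⊖ n) ≈ m ×′ 1# - n ×′ 1#
  fromInteger-⊖ m       zero    = begin
    m ×′ 1#        ≈⟨ +-identityʳ _ ⟨
    m ×′ 1# + 0#   ≈⟨ +-congˡ -0#≈0# ⟨
    m ×′ 1# - 0#   ∎
  fromInteger-⊖ zero    (suc n) = sym (+-identityˡ _)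
  fromInteger-⊖ (suc m) (suc n) = begin
    fromInteger (suc m ⊖ suc n)            ≡⟨ ≡.cong fromInteger (ℤ.[1+m]⊖[1+n]≡m⊖n m n) ⟩
    fromInteger (m ⊖ n)                    ≈⟨ fromInteger-⊖ m n ⟩
    a - b                                  ≈⟨ +-congʳ (+-identityˡ a) ⟨
    (0# + a) - b                           ≈⟨ +-congʳ (+-congʳ (-‿inverseʳ 1#)) ⟨
    ((1# - 1#) + a) - b                    ≈⟨ +-congʳ (trans (+-congʳ (+-comm _ _)) (+-assoc _ _ _)) ⟩
    (- 1# + (1# + a)) - b                  ≈⟨ trans (+-congʳ (+-comm _ _)) (+-assoc _ _ _) ⟩
    (1# + a) + (- 1# - b)                  ≈⟨ +-congˡ (⁻¹-∙-comm 1# b) ⟩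
    (1# + a) - (1# + b)                    ≈⟨ +-cong (1+× m 1#) (-‿cong (1+× n 1#)) ⟨
    suc m ×′ 1# - suc n ×′ 1#              ∎
    where
    a = m ×′ 1#
    b = n ×′ 1#

  fromInteger-neg : ∀ i → fromInteger (ℤ.- i) ≈ - fromInteger i
  fromInteger-neg (+ zero)  = sym -0#≈0#
  fromInteger-neg (+ suc n) = refl
  fromInteger-neg -[1+ n ]  = sym (-‿involutive _)

  fromInteger-+ : ∀ i j → fromInteger (i ℤ.+ j) ≈ fromInteger i + fromInteger j
  fromInteger-+ (+ m)    (+ n)    = ×-homo-+ 1# m n
  fromInteger-+ (+ m)    -[1+ n ] = fromInteger-⊖ m (suc n)
  fromInteger-+ -[1+ m ] (+ n)    = trans (fromInteger-⊖ n (suc m)) (+-comm _ _)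
  fromInteger-+ -[1+ m ] -[1+ n ] = begin
    - (suc (suc (m ℕ.+ n)) ×′ 1#)    ≡⟨ ≡.cong (λ k → - (k ×′ 1#)) (ℕ.+-suc (suc m) n) ⟨
    - ((suc m ℕ.+ suc n) ×′ 1#)      ≈⟨ -‿cong (×-homo-+ 1# (suc m) (suc n)) ⟩
    - (suc m ×′ 1# + suc n ×′ 1#)    ≈⟨ ⁻¹-∙-comm _ _ ⟨
    - (suc m ×′ 1#) - (suc n ×′ 1#)  ∎

  fromInteger-+* : ∀ m j → fromInteger (+ m ℤ.* j) ≈ m ×′ 1# * fromInteger j
  fromInteger-+* m (+ n)    = begin
    fromInteger (+ m ℤ.* + n)  ≡⟨ ≡.cong fromInteger (ℤ.pos-* m n) ⟨
    (m ℕ.* n) ×′ 1#            ≈⟨ ×1-homo-* m n ⟩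
    m ×′ 1# * n ×′ 1#          ∎
  fromInteger-+* m -[1+ n ] = begin
    fromInteger (+ m ℤ.* (ℤ.- + suc n))    ≡⟨ ≡.cong fromInteger (ℤ.neg-distribʳ-* (+ m) (+ suc n)) ⟨
    fromInteger (ℤ.- (+ m ℤ.* + suc n))    ≈⟨ fromInteger-neg (+ m ℤ.* + suc n) ⟩
    - fromInteger (+ m ℤ.* + suc n)        ≈⟨ -‿cong (fromInteger-+* m (+ suc n)) ⟩
    - (m ×′ 1# * suc n ×′ 1#)              ≈⟨ -‿distribʳ-* _ _ ⟩
    m ×′ 1# * - (suc n ×′ 1#)              ∎

  fromInteger-* : ∀ i j → fromInteger (i ℤ.* j) ≈ fromInteger i * fromInteger j
  fromInteger-* (+ m)    j = fromInteger-+* m j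
  fromInteger-* -[1+ m ] j = begin
    fromInteger ((ℤ.- + suc m) ℤ.* j)  ≡⟨ ≡.cong fromInteger (ℤ.neg-distribˡ-* (+ suc m) j) ⟨
    fromInteger (ℤ.- (+ suc m ℤ.* j))  ≈⟨ fromInteger-neg (+ suc m ℤ.* j) ⟩
    - fromInteger (+ suc m ℤ.* j)      ≈⟨ -‿cong (fromInteger-+* (suc m) j) ⟩
    - (suc m ×′ 1# * fromInteger j)    ≈⟨ -‿distribˡ-* _ _ ⟩
    - (suc m ×′ 1#) * fromInteger j    ∎

  fromInteger-homo : ℤ.+-*-rawRing -Raw-AlmostCommutative⟶ fromCommutativeRing A
  fromInteger-homo = record
    { ⟦_⟧    = fromInteger
    ; +-homo = fromInteger-+
    ; *-homo = fromInteger-*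
    ; -‿homo = fromInteger-neg
    ; 0-homo = refl
    ; 1-homo = refl
    }

  fromInteger-≟ : ∀ i j → Maybe (fromInteger i ≈ fromInteger j)
  fromInteger-≟ i j with i ℤ.≟ j
  ... | yes i≡j = just (reflexive (≡.cong fromInteger i≡j))
  ... | no _    = nothing

  open RingSolver ℤ.+-*-rawRing (fromCommutativeRing A) fromInteger-homo fromInteger-≟ public

-- Order and arithmetic in an ordered field.

module OrderedField (R : RealField) where

  open RealField R
  open IntegerCoefficientSolver commutativeRing
    using (solve; _:=_; _:+_; _:*_; _:-_)
  open SemiringExp semiring using (_^_)

  strictTotalOrder : StrictTotalOrder 0ℓ 0ℓ 0ℓ
  strictTotalOrder = record { isStrictTotalOrder = isStrictTotalOrder }

  open StrictTotalOrder strictTotalOrder public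
    using (compare; strictPartialOrder; <-resp-≈; <-respˡ-≈; <-respʳ-≈)
    renaming (irrefl to <-irrefl; trans to <-trans)

  module ≤-Reasoning = StrictReasoning strictPartialOrder

  private module NonStrict = StrictToNonStrict _≈_ _<_

  ≤-refl : ∀ {x} → x ≤ x
  ≤-refl = inj₂ refl

  ≤-trans : ∀ {x y z} → x ≤ y → y ≤ z → x ≤ z
  ≤-trans = NonStrict.trans isEquivalence <-resp-≈ <-trans

  ≤-antisym : ∀ {x y} → x ≤ y → y ≤ x → x ≈ y
  ≤-antisym = NonStrict.antisym isEquivalence <-trans <-irrefl

  <-≤-trans : ∀ {x y z} → x < y → y ≤ z → x < z
  <-≤-trans = NonStrict.<-≤-trans <-trans <-respʳ-≈

  ≤-<-trans : ∀ {x y z} → x ≤ y → y < z → x < z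
  ≤-<-trans = NonStrict.≤-<-trans sym <-trans <-respˡ-≈

  ≤-respʳ-≈ : ∀ {x y z} → y ≈ z → x ≤ y → x ≤ z
  ≤-respʳ-≈ y≈z x≤y = ≤-trans x≤y (inj₂ y≈z)

  ≤-respˡ-≈ : ∀ {x y z} → y ≈ z → y ≤ x → z ≤ x
  ≤-respˡ-≈ y≈z y≤x = ≤-trans (inj₂ (sym y≈z)) y≤x

  <⇒≱ : ∀ {x y} → x < y → ¬ y ≤ x
  <⇒≱ x<y y≤x = <-irrefl refl (<-≤-trans x<y y≤x)

  <-≤-connex : ∀ x y → x < y ⊎ y ≤ x
  <-≤-connex x y with compare x y
  ... | tri< x<y _ _ = inj₁ x<y
  ... | tri≈ _ x≈y _ = inj₂ (inj₂ (sym x≈y))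
  ... | tri> _ _ y<x = inj₂ (inj₁ y<x)

  ≮⇒≥ : ∀ {x y} → ¬ x < y → y ≤ x
  ≮⇒≥ {x} {y} x≮y with <-≤-connex x y
  ... | inj₁ x<y = contradiction x<y x≮y
  ... | inj₂ y≤x = y≤x

  x<y⇒0<y-x : ∀ {x y} → x < y → 0# < y - x
  x<y⇒0<y-x {x} x<y = <-respˡ-≈ (-‿inverseʳ x) (+-monoˡ-< (- x) x<y)

  x≤y⇒0≤y-x : ∀ {x y} → x ≤ y → 0# ≤ y - x
  x≤y⇒0≤y-x (inj₁ x<y)     = inj₁ (x<y⇒0<y-x x<y)
  x≤y⇒0≤y-x {x} (inj₂ x≈y) = inj₂ (trans (sym (-‿inverseʳ x)) (+-congʳ x≈y))

  private
    +-cancels : ∀ x y d → y - x ≈ d → d + x ≈ y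
    +-cancels x y d eq = trans (+-congʳ (sym eq))
      (solve 2 (λ x y → (y :- x) :+ x := y) refl x y)

  -- Inequalities are proved by exhibiting the difference of their sides as an
  -- evidently positive (non-negative) expression.
  <-by : ∀ {x y d} → 0# < d → y - x ≈ d → x < y
  <-by {x} {y} {d} 0<d eq =
    <-respˡ-≈ (+-identityˡ x) (<-respʳ-≈ (+-cancels x y d eq) (+-monoˡ-< x 0<d))

  ≤-by : ∀ {x y d} → 0# ≤ d → y - x ≈ d → x ≤ y
  ≤-by (inj₁ 0<d) eq = inj₁ (<-by 0<d eq)
  ≤-by {x} {y} {d} (inj₂ 0≈d) eq =
    inj₂ (trans (sym (+-identityˡ x)) (trans (+-congʳ 0≈d) (+-cancels x y d eq)))

  +-mono-≤-< : ∀ {a b c d} → a ≤ b → c < d → a + c < b + d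
  +-mono-≤-< {a} {b} {c} {d} (inj₁ a<b) c<d =
    <-trans (+-monoˡ-< c a<b)
      (<-respʳ-≈ (+-comm d b) (<-respˡ-≈ (+-comm c b) (+-monoˡ-< b c<d)))
  +-mono-≤-< {a} {b} {c} {d} (inj₂ a≈b) c<d =
    <-respʳ-≈ (+-comm d b) (<-respˡ-≈ (trans (+-comm c b) (+-congʳ (sym a≈b))) (+-monoˡ-< b c<d))

  +-mono-≤ : ∀ {a b c d} → a ≤ b → c ≤ d → a + c ≤ b + d
  +-mono-≤ a≤b (inj₁ c<d) = inj₁ (+-mono-≤-< a≤b c<d)
  +-mono-≤ {a} {b} {c} {d} (inj₁ a<b) (inj₂ c≈d) =
    inj₁ (<-respʳ-≈ (+-congˡ c≈d) (+-monoˡ-< c a<b))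
  +-mono-≤ (inj₂ a≈b) (inj₂ c≈d) = inj₂ (+-cong a≈b c≈d)

  +-nonNegative : ∀ {x y} → 0# ≤ x → 0# ≤ y → 0# ≤ x + y
  +-nonNegative 0≤x 0≤y = ≤-respˡ-≈ (+-identityˡ 0#) (+-mono-≤ 0≤x 0≤y)

  +-positive : ∀ {x y} → 0# ≤ x → 0# < y → 0# < x + y
  +-positive 0≤x 0<y = <-respˡ-≈ (+-identityˡ 0#) (+-mono-≤-< 0≤x 0<y)

  *-nonNegative : ∀ {x y} → 0# ≤ x → 0# ≤ y → 0# ≤ x * y
  *-nonNegative (inj₁ 0<x) (inj₁ 0<y) = inj₁ (*-positive 0<x 0<y)
  *-nonNegative {x} {y} (inj₂ 0≈x) _  = inj₂ (trans (sym (zeroˡ y)) (*-congʳ 0≈x))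
  *-nonNegative {x} {y} _ (inj₂ 0≈y)  = inj₂ (trans (sym (zeroʳ x)) (*-congˡ 0≈y))

  *-monoʳ-< : ∀ {a b c} → 0# < c → a < b → c * a < c * b
  *-monoʳ-< {a} {b} {c} 0<c a<b = <-by (*-positive 0<c (x<y⇒0<y-x a<b))
    (solve 3 (λ a b c → c :* b :- c :* a := c :* (b :- a)) refl a b c)

  *-monoʳ-≤ : ∀ {a b c} → 0# ≤ c → a ≤ b → c * a ≤ c * b
  *-monoʳ-≤ {a} {b} {c} 0≤c a≤b = ≤-by (*-nonNegative 0≤c (x≤y⇒0≤y-x a≤b))
    (solve 3 (λ a b c → c :* b :- c :* a := c :* (b :- a)) refl a b c)

  *-mono-≤ : ∀ {a b c d} → 0# ≤ a → 0# ≤ d → a ≤ b → c ≤ d → a * c ≤ b * d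
  *-mono-≤ {a} {b} {c} {d} 0≤a 0≤d a≤b c≤d = ≤-trans (*-monoʳ-≤ 0≤a c≤d)
    (≤-respˡ-≈ (*-comm d a) (≤-respʳ-≈ (*-comm d b) (*-monoʳ-≤ 0≤d a≤b)))

  *-cancelˡ-≤ : ∀ {a b c} → 0# < c → c * a ≤ c * b → a ≤ b
  *-cancelˡ-≤ {a} {b} 0<c ca≤cb with <-≤-connex b a
  ... | inj₂ a≤b = a≤b
  ... | inj₁ b<a = contradiction ca≤cb (<⇒≱ (*-monoʳ-< 0<c b<a))

  *-cancelˡ-< : ∀ {a b c} → 0# < c → c * a < c * b → a < b
  *-cancelˡ-< {a} {b} 0<c ca<cb with <-≤-connex a b
  ... | inj₁ a<b = a<b
  ... | inj₂ b≤a = contradiction (*-monoʳ-≤ (inj₁ 0<c) b≤a) (<⇒≱ ca<cb)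

  *-cancelˡ-≈ : ∀ {a b c} → 0# < c → c * a ≈ c * b → a ≈ b
  *-cancelˡ-≈ 0<c eq =
    ≤-antisym (*-cancelˡ-≤ 0<c (inj₂ eq)) (*-cancelˡ-≤ 0<c (inj₂ (sym eq)))

  >⇒≉ : ∀ {x} → 0# < x → ¬ x ≈ 0#
  >⇒≉ 0<x x≈0 = <-irrefl (sym x≈0) 0<x

  *-⁻¹ : ∀ {x} → 0# < x → x * x ⁻¹ ≈ 1#
  *-⁻¹ 0<x = *-inverseʳ (>⇒≉ 0<x)

  ⁻¹-positive : ∀ {x} → 0# < x → 0# < x ⁻¹
  ⁻¹-positive {x} 0<x = *-cancelˡ-< 0<x
    (<-respˡ-≈ (sym (zeroʳ x)) (<-respʳ-≈ (sym (*-⁻¹ 0<x)) 0<1))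

  1<⇒0< : ∀ {x} → 1# < x → 0# < x
  1<⇒0< = <-trans 0<1

  ^-nonNegative : ∀ {x} n → 0# ≤ x → 0# ≤ x ^ n
  ^-nonNegative zero    0≤x = inj₁ 0<1
  ^-nonNegative (suc n) 0≤x = *-nonNegative 0≤x (^-nonNegative n 0≤x)

  ^-mono-≤ : ∀ {x y} n → 0# ≤ x → x ≤ y → x ^ n ≤ y ^ n
  ^-mono-≤ zero    0≤x x≤y = ≤-refl
  ^-mono-≤ (suc n) 0≤x x≤y =
    *-mono-≤ 0≤x (^-nonNegative n (≤-trans 0≤x x≤y)) x≤y (^-mono-≤ n 0≤x x≤y)

  ^-positive : ∀ {x} n → 0# < x → 0# < x ^ n
  ^-positive zero    0<x = 0<1
  ^-positive (suc n) 0<x = *-positive 0<x (^-positive n 0<x)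

  ^-mono-< : ∀ {x y} n → 0# < x → x < y → x ^ suc n < y ^ suc n
  ^-mono-< {x} {y} n 0<x x<y = ≤-<-trans
    (*-monoʳ-≤ (inj₁ 0<x) (^-mono-≤ n (inj₁ 0<x) (inj₁ x<y)))
    (<-respˡ-≈ (*-comm _ x) (<-respʳ-≈ (*-comm _ y)
      (*-monoʳ-< (^-positive n (<-trans 0<x x<y)) x<y)))

  ^-injective : ∀ {x y} n → 0# < x → 0# < y → x ^ suc n ≈ y ^ suc n → x ≈ y
  ^-injective {x} {y} n 0<x 0<y eq with compare x y
  ... | tri≈ _ x≈y _ = x≈y
  ... | tri< x<y _ _ = contradiction (^-mono-< n 0<x x<y) (<-irrefl eq)
  ... | tri> _ _ y<x = contradiction (^-mono-< n 0<y y<x) (<-irrefl (sym eq))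

-- The Archimedean property and integer floors.

module Floor (em : ExcludedMiddle 0ℓ) (R : RealField) where

  open RealField R
  open Analysis em R
  open OrderedField R
  open IntegerCoefficientSolver commutativeRing
    using (solve; _:=_; _:+_; _:-_; :-_; con)

  choose-satisfies : {A : Set} (d : A) (P : Pred A 0ℓ) → ∃ P → P (choose d P)
  choose-satisfies d P ∃P with em {Σ _ P}
  ... | yes (_ , p) = p
  ... | no ¬∃P      = contradiction ∃P ¬∃P

  0≤fromℕ : ∀ n → 0# ≤ fromℕ n
  0≤fromℕ zero    = ≤-refl
  0≤fromℕ (suc n) = +-nonNegative (inj₁ 0<1) (0≤fromℕ n)

  0<fromℕ[1+n] : ∀ n → 0# < fromℕ (suc n)
  0<fromℕ[1+n] n = <-respʳ-≈ (+-comm _ 1#) (+-positive (0≤fromℕ n) 0<1)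

  0<fromℕ : ∀ {n} → 0 ℕ.< n → 0# < fromℕ n
  0<fromℕ {suc n} _ = 0<fromℕ[1+n] n

  fromℕ-mono-≤ : ∀ {m n} → m ℕ.≤ n → fromℕ m ≤ fromℕ n
  fromℕ-mono-≤ {n = n} z≤n = 0≤fromℕ n
  fromℕ-mono-≤ (s≤s m≤n)   = +-mono-≤ ≤-refl (fromℕ-mono-≤ m≤n)

  -- If no natural exceeds x, the naturals have a supremum s. Since n + 1 ≤ s for every n, s - 1 is
  -- also an upper bound, against leastness.
  archimedean : ∀ x → ∃ λ n → x < fromℕ n
  archimedean x with em {∃ λ n → x < fromℕ n}
  ... | yes ∃n = ∃n
  ... | no ∄n  = contradiction (least s-1-bound) (<⇒≱ s-1<s)
    where
    Naturals : Pred Carrier 0ℓ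
    Naturals y = ∃ λ n → y ≈ fromℕ n

    x-bound : UpperBound Naturals x
    x-bound (n , y≈n) with <-≤-connex x (fromℕ n)
    ... | inj₁ x<n = contradiction (n , x<n) ∄n
    ... | inj₂ n≤x = ≤-respˡ-≈ (sym y≈n) n≤x

    sup = supremum Naturals (0# , 0 , refl) (x , x-bound)
    s = proj₁ sup
    bound = proj₁ (proj₂ sup)
    least = proj₂ (proj₂ sup)

    s-1-bound : UpperBound Naturals (s - 1#)
    s-1-bound {y} (n , y≈n) = ≤-by
      (x≤y⇒0≤y-x (bound (suc n , +-congˡ y≈n)))
      (solve 2 (λ s y → (s :- con (+ 1)) :- y := s :- (con (+ 1) :+ y)) refl s y)

    s-1<s : s - 1# < s
    s-1<s = <-by 0<1 (solve 1 (λ s → s :- (s :- con (+ 1)) := con (+ 1)) refl s)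

  ℕ-floor : ∀ {x} → 0# ≤ x → ∃ λ n → fromℕ n ≤ x × x < fromℕ n + 1#
  ℕ-floor {x} 0≤x = search (proj₁ (archimedean x)) (proj₂ (archimedean x))
    where
    search : ∀ N → x < fromℕ N → ∃ λ n → fromℕ n ≤ x × x < fromℕ n + 1#
    search zero    x<0 = contradiction 0≤x (<⇒≱ x<0)
    search (suc N) x<1+N with <-≤-connex x (fromℕ N)
    ... | inj₁ x<N = search N x<N
    ... | inj₂ N≤x = N , N≤x , <-respʳ-≈ (+-comm 1# _) x<1+N

  -- Shifting by 1 reduces to the natural floor of x + 1, so the integer floor is at least -1.
  floor-exists : ∀ {x} → 0# ≤ x + 1# → ∃ (IsFloor x)
  floor-exists {x} 0≤x+1 with ℕ-floor 0≤x+1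
  ... | zero  , 0≤ , <1  = -[1+ 0 ] ,
    ≤-by 0≤ (solve 1 (λ x → x :- (:- (con (+ 1) :+ con (+ 0))) := x :+ con (+ 1)) refl x) ,
    <-by (x<y⇒0<y-x <1)
      (solve 1 (λ x → ((:- (con (+ 1) :+ con (+ 0))) :+ con (+ 1)) :- x
                      := (con (+ 0) :+ con (+ 1)) :- (x :+ con (+ 1))) refl x)
  ... | suc m , m≤ , <1+m = + m ,
    ≤-by (x≤y⇒0≤y-x m≤)
      (solve 2 (λ x m → x :- m := (x :+ con (+ 1)) :- (con (+ 1) :+ m)) refl x (fromℕ m)) ,
    <-by (x<y⇒0<y-x <1+m)
      (solve 2 (λ x m → (m :+ con (+ 1)) :- x
                        := ((con (+ 1) :+ m) :+ con (+ 1)) :- (x :+ con (+ 1))) refl x (fromℕ m))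

  fromℤ-suc : ∀ k → fromℤ (ℤ.suc k) ≈ fromℤ k + 1#
  fromℤ-suc (+ n)        = +-comm 1# _
  fromℤ-suc -[1+ zero ]  =
    solve 0 (con (+ 0) := (:- (con (+ 1) :+ con (+ 0))) :+ con (+ 1)) refl
  fromℤ-suc -[1+ suc n ] =
    solve 1 (λ m → :- m := (:- (con (+ 1) :+ m)) :+ con (+ 1)) refl (fromℕ (suc n))

  neg-mono-≤ : ∀ {x y} → x ≤ y → - y ≤ - x
  neg-mono-≤ {x} {y} x≤y = ≤-by (x≤y⇒0≤y-x x≤y)
    (solve 2 (λ x y → (:- x) :- (:- y) := y :- x) refl x y)

  fromℤ-mono-≤ : ∀ {i j} → i ℤ.≤ j → fromℤ i ≤ fromℤ j
  fromℤ-mono-≤ (ℤ.-≤- n≤m) = neg-mono-≤ (fromℕ-mono-≤ (s≤s n≤m))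
  fromℤ-mono-≤ { -[1+ m ] } {+ n} ℤ.-≤+ = ≤-by
    (+-nonNegative (0≤fromℕ n) (0≤fromℕ (suc m)))
    (solve 2 (λ m n → n :- (:- m) := n :+ m) refl (fromℕ (suc m)) (fromℕ n))
  fromℤ-mono-≤ (ℤ.+≤+ m≤n) = fromℕ-mono-≤ m≤n

  IsFloor-≮ : ∀ {x i j} → IsFloor x i → IsFloor x j → ¬ i ℤ.< j
  IsFloor-≮ {i = i} (_ , x<i+1) (j≤x , _) i<j = <⇒≱ x<i+1
    (≤-trans (≤-respˡ-≈ (fromℤ-suc i) (fromℤ-mono-≤ (ℤ.i<j⇒suc[i]≤j i<j))) j≤x)

  IsFloor-unique : ∀ {x i j} → IsFloor x i → IsFloor x j → i ≡ j
  IsFloor-unique p q = ℤ.≤-antisym (ℤ.≮⇒≥ (IsFloor-≮ q p)) (ℤ.≮⇒≥ (IsFloor-≮ p q))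

  ⌊⌋-unique : ∀ {x k} → IsFloor x k → ⌊ x ⌋ ≡ k
  ⌊⌋-unique {x} {k} p = IsFloor-unique (choose-satisfies (+ 0) (IsFloor x) (k , p)) p

  IsFloor-resp-≈ : ∀ {x y k} → x ≈ y → IsFloor x k → IsFloor y k
  IsFloor-resp-≈ x≈y (k≤x , x<k+1) = ≤-respʳ-≈ x≈y k≤x , <-respˡ-≈ x≈y x<k+1

  IsFloor-+1 : ∀ {x k} → IsFloor x k → IsFloor (x + 1#) (ℤ.suc k)
  IsFloor-+1 {k = k} (k≤x , x<k+1) =
    ≤-respˡ-≈ (sym (fromℤ-suc k)) (+-mono-≤ k≤x ≤-refl) ,
    <-respʳ-≈ (+-congʳ (sym (fromℤ-suc k))) (+-monoˡ-< 1# x<k+1)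

  -- Here v lies in [k, k + 2), and comparing it with k + 1 decides the floor. The endpoint v = t +
  -- 1 is harmless, as its floor is k + 1.
  between-floors : ∀ {t v k} → IsFloor t k → t ≤ v → v ≤ t + 1# →
                   IsFloor v k ⊎ IsFloor v (ℤ.suc k)
  between-floors {t} {v} {k} t-floor@(k≤t , _) t≤v v≤t+1
    with <-≤-connex v (fromℤ k + 1#)
  ... | inj₁ v<k+1 = inj₁ (≤-trans k≤t t≤v , v<k+1)
  ... | inj₂ k+1≤v = inj₂ (≤-respˡ-≈ (sym (fromℤ-suc k)) k+1≤v ,
                           ≤-<-trans v≤t+1 (proj₂ (IsFloor-+1 {k = k} t-floor)))

-- Finite sums and partial sums of the exponential series.

module PartialSums (em : ExcludedMiddle 0ℓ) (R : RealField) where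

  open RealField R
  open Analysis em R
  open OrderedField R
  open Floor em R
  open IntegerCoefficientSolver commutativeRing
    using (solve; _:=_; _:+_; _:*_; _:-_; :-_; con)
  open SemiringExp semiring using (_^_; ^-congˡ)
  open SemiringMult semiring using (×-assoc-*; ×1-homo-*; ×-congʳ) renaming (_×_ to _×ᴿ_)
  open SemiringSum semiring
    using (sum; sum-cong-≋; ∑-distrib-+; *-distribˡ-sum; *-distribʳ-sum)

  -- Summands are indexed by ℕ rather than `Fin m`, so that sums of different lengths can share one
  -- f; `∑ m (expTerm x)` unfolds to `expSum x m`.
  ∑ : ℕ → (ℕ → Carrier) → Carrier
  ∑ m f = sum {m} (λ k → f (toℕ k))

  ∑-cong : ∀ m {f g} → (∀ k → f k ≈ g k) → ∑ m f ≈ ∑ m g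
  ∑-cong m f≈g = sum-cong-≋ {m} (λ k → f≈g (toℕ k))

  ∑-+ : ∀ m f g → ∑ m (λ k → f k + g k) ≈ ∑ m f + ∑ m g
  ∑-+ m f g = ∑-distrib-+ {m} (λ k → f (toℕ k)) (λ k → g (toℕ k))

  ∑-nonNegative : ∀ m {f} → (∀ k → 0# ≤ f k) → 0# ≤ ∑ m f
  ∑-nonNegative zero    0≤f = ≤-refl
  ∑-nonNegative (suc m) 0≤f = +-nonNegative (0≤f 0) (∑-nonNegative m (λ k → 0≤f (suc k)))

  ∑-mono-≤ : ∀ m {f g} → (∀ k → f k ≤ g k) → ∑ m f ≤ ∑ m g
  ∑-mono-≤ zero    f≤g = ≤-refl
  ∑-mono-≤ (suc m) f≤g = +-mono-≤ (f≤g 0) (∑-mono-≤ m (λ k → f≤g (suc k)))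

  ∑-monoˡ-≤ : ∀ {m n f} → (∀ k → 0# ≤ f k) → m ℕ.≤ n → ∑ m f ≤ ∑ n f
  ∑-monoˡ-≤ {n = n} 0≤f z≤n = ∑-nonNegative n 0≤f
  ∑-monoˡ-≤ 0≤f (s≤s m≤n)   = +-mono-≤ ≤-refl (∑-monoˡ-≤ (λ k → 0≤f (suc k)) m≤n)

  rectangle : (ℕ → ℕ → Carrier) → ℕ → ℕ → Carrier
  rectangle a m n = ∑ m (λ i → ∑ n (a i))

  antidiagonal : (ℕ → ℕ → Carrier) → ℕ → Carrier
  antidiagonal a n = ∑ (suc n) (λ k → a k (n ℕ.∸ k))

  triangle : (ℕ → ℕ → Carrier) → ℕ → Carrier
  triangle a n = ∑ n (antidiagonal a)

  triangle-+ : ∀ {a b c} n → (∀ i j → a i j + b i j ≈ c i j) →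
               triangle a n + triangle b n ≈ triangle c n
  triangle-+ {a} {b} n a+b≈c = trans (sym (∑-+ n (antidiagonal a) (antidiagonal b))) (∑-cong n λ i →
    trans (sym (∑-+ (suc i) (λ k → a k (i ℕ.∸ k)) (λ k → b k (i ℕ.∸ k))))
          (∑-cong (suc i) λ k → a+b≈c k (i ℕ.∸ k)))

  -- Peels off the row i = 0 instead of the last antidiagonal. The rows that remain form a triangle
  -- one size smaller, which allows induction on rows when comparing with rectangles.
  triangle-suc : ∀ a n →
    triangle a (suc n) ≈ ∑ (suc n) (a 0) + triangle (λ i → a (suc i)) n
  triangle-suc a n = trans
    (+-cong (+-identityʳ (a 0 0))
            (∑-+ n (λ k → a 0 (suc k)) (antidiagonal (λ i → a (suc i)))))
    (sym (+-assoc _ _ _))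

  triangle≤rectangle : ∀ {a} m n → (∀ i j → 0# ≤ a i j) → m ℕ.≤ n →
                       triangle a m ≤ rectangle a m n
  triangle≤rectangle zero n 0≤a _ = ≤-refl
  triangle≤rectangle {a} (suc m) n 0≤a m<n = ≤-respˡ-≈ (sym (triangle-suc a m))
    (+-mono-≤ (∑-monoˡ-≤ (0≤a 0) m<n)
              (triangle≤rectangle m n (λ i → 0≤a (suc i)) (ℕ.<⇒≤ m<n)))

  -- Every index pair with i < m and j < n satisfies i + j < m + n.
  rectangle≤triangle : ∀ {a} m n → (∀ i j → 0# ≤ a i j) →
                       rectangle a m n ≤ triangle a (m ℕ.+ n)
  rectangle≤triangle {a} zero n 0≤a =
    ∑-nonNegative n (λ k → ∑-nonNegative (suc k) (λ i → 0≤a i (k ℕ.∸ i)))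
  rectangle≤triangle {a} (suc m) n 0≤a = ≤-respʳ-≈ (sym (triangle-suc a (m ℕ.+ n)))
    (+-mono-≤ (∑-monoˡ-≤ (0≤a 0) (ℕ.m≤n+m n (suc m)))
              (rectangle≤triangle m n (λ i → 0≤a (suc i))))

  rectangle-product : ∀ u v m n → rectangle (λ i j → u i * v j) m n ≈ ∑ m u * ∑ n v
  rectangle-product u v m n = trans
    (∑-cong m λ i → sym (*-distribˡ-sum (u i) (λ k → v (toℕ {n} k))))
    (sym (*-distribʳ-sum (∑ n v) (λ k → u (toℕ {m} k))))

  expTerm : Carrier → ℕ → Carrier
  expTerm y k = y ^ k / fromℕ (k !)

  0<fromℕ[k!] : ∀ k → 0# < fromℕ (k !)
  0<fromℕ[k!] k = 0<fromℕ (ℕ.1≤n! k)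

  expTerm-nonNegative : ∀ {x} → 0# ≤ x → ∀ k → 0# ≤ expTerm x k
  expTerm-nonNegative 0≤x k =
    *-nonNegative (^-nonNegative k 0≤x) (inj₁ (⁻¹-positive (0<fromℕ[k!] k)))

  expTerm-cong : ∀ {x y} → x ≈ y → ∀ k → expTerm x k ≈ expTerm y k
  expTerm-cong x≈y k = *-congʳ (^-congˡ k x≈y)

  expSum-cong : ∀ {x y} → x ≈ y → ∀ m → expSum x m ≈ expSum y m
  expSum-cong x≈y m = ∑-cong m (expTerm-cong x≈y)

  expTerm-0 : ∀ x → expTerm x 0 ≈ 1#
  expTerm-0 x = trans (*-congʳ (sym (+-identityʳ 1#))) (*-⁻¹ (0<fromℕ[1+n] 0))

  -- The recurrence of the series with the division by k + 1 cleared.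
  expTerm-suc : ∀ x k → fromℕ (suc k) * expTerm x (suc k) ≈ x * expTerm x k
  expTerm-suc x k = *-cancelˡ-≈ (0<fromℕ[k!] k) (begin-equality
    f * (s * (x * p * (fromℕ (suc k !)) ⁻¹))  ≈⟨ solve 5 (λ f s x p i →
        f :* (s :* (x :* p :* i)) := x :* p :* ((s :* f) :* i)) refl f s x p _ ⟩
    x * p * ((s * f) * (fromℕ (suc k !)) ⁻¹)  ≈⟨ *-congˡ (*-congʳ (×1-homo-* (suc k) (k !))) ⟨
    x * p * (fromℕ (suc k !) * (fromℕ (suc k !)) ⁻¹)  ≈⟨ *-congˡ (*-⁻¹ (0<fromℕ[k!] (suc k))) ⟩
    x * p * 1#          ≈⟨ *-congˡ (*-⁻¹ (0<fromℕ[k!] k)) ⟨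
    x * p * (f * f ⁻¹)  ≈⟨ solve 4 (λ f x p i →
        x :* p :* (f :* i) := f :* (x :* (p :* i))) refl f x p _ ⟩
    f * (x * (p * f ⁻¹))  ∎)
    where
    open ≤-Reasoning
    f = fromℕ (k !)
    s = fromℕ (suc k)
    p = x ^ k

  expTerm-1 : ∀ x → expTerm x 1 ≈ x
  expTerm-1 x = begin-equality
    expTerm x 1               ≈⟨ solve 1 (λ t → t := (con (+ 1) :+ con (+ 0)) :* t) refl _ ⟩
    fromℕ 1 * expTerm x 1     ≈⟨ expTerm-suc x 0 ⟩
    x * expTerm x 0           ≈⟨ *-congˡ (expTerm-0 x) ⟩
    x * 1#                    ≈⟨ *-identityʳ x ⟩
    x                         ∎
    where open ≤-Reasoning

  nCk*k![n-k]!≡n! : ∀ {n k} → k ℕ.≤ n → (n C k) ℕ.* (k ! ℕ.* (n ℕ.∸ k) !) ≡ n !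
  nCk*k![n-k]!≡n! {n} {k} k≤n = ≡.trans
    (≡.cong (ℕ._* (k ! ℕ.* (n ℕ.∸ k) !)) (nCk≡n!/k![n-k]! k≤n))
    (m/n*n≡m {{k ℕ.!* (n ℕ.∸ k) !≢0}} (k![n∸k]!∣n! k≤n))

  binomialTerm-/-! : ∀ {n k} → k ℕ.≤ n → ∀ x y →
    ((n C k) ×ᴿ (x ^ k * y ^ (n ℕ.∸ k))) / fromℕ (n !)
      ≈ expTerm x k * expTerm y (n ℕ.∸ k)
  binomialTerm-/-! {n} {k} k≤n x y = *-cancelˡ-≈ (0<fromℕ[k!] n) (begin-equality
    N * (((n C k) ×ᴿ (X * Y)) * N ⁻¹)
      -- The inserted `1#` lets `×-assoc-*` turn the repeated sum into a product with B.
      ≈⟨ *-congˡ (*-congʳ (×-congʳ (n C k) (*-identityˡ (X * Y)))) ⟨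
    N * (((n C k) ×ᴿ (1# * (X * Y))) * N ⁻¹)
      ≈⟨ *-congˡ (*-congʳ (×-assoc-* (n C k) 1# (X * Y))) ⟨
    N * (B * (X * Y) * N ⁻¹)
      ≈⟨ solve 5 (λ N B X Y i → N :* (B :* (X :* Y) :* i) := B :* X :* Y :* (N :* i))
           refl N B X Y _ ⟩
    B * X * Y * (N * N ⁻¹)
      ≈⟨ *-congˡ (*-⁻¹ (0<fromℕ[k!] n)) ⟩
    B * X * Y * 1#
      ≈⟨ solve 3 (λ B X Y → B :* X :* Y :* con (+ 1)
                            := B :* X :* Y :* con (+ 1) :* con (+ 1)) refl B X Y ⟩
    B * X * Y * 1# * 1#
      ≈⟨ *-cong (*-congˡ (*-⁻¹ (0<fromℕ[k!] k))) (*-⁻¹ (0<fromℕ[k!] (n ℕ.∸ k))) ⟨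
    B * X * Y * (K * K ⁻¹) * (L * L ⁻¹)
      ≈⟨ solve 7 (λ B X Y K k L l → B :* X :* Y :* (K :* k) :* (L :* l)
                                    := (B :* (K :* L)) :* (X :* k :* (Y :* l)))
           refl B X Y K _ L _ ⟩
    (B * (K * L)) * (X * K ⁻¹ * (Y * L ⁻¹))
      ≈⟨ *-congʳ B*K*L≈N ⟩
    N * (X * K ⁻¹ * (Y * L ⁻¹)) ∎)
    where
    open ≤-Reasoning
    N = fromℕ (n !)
    B = fromℕ (n C k)
    K = fromℕ (k !)
    L = fromℕ ((n ℕ.∸ k) !)
    X = x ^ k
    Y = y ^ (n ℕ.∸ k)
    B*K*L≈N : B * (K * L) ≈ N
    B*K*L≈N = begin-equality
      B * (K * L)                               ≈⟨ *-congˡ (×1-homo-* (k !) ((n ℕ.∸ k) !)) ⟨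
      B * fromℕ (k ! ℕ.* (n ℕ.∸ k) !)           ≈⟨ ×1-homo-* (n C k) _ ⟨
      fromℕ ((n C k) ℕ.* (k ! ℕ.* (n ℕ.∸ k) !)) ≡⟨ ≡.cong fromℕ (nCk*k![n-k]!≡n! k≤n) ⟩
      N                                         ∎

  -- The binomial theorem divided by n!. It holds for arguments of any sign, so it also applies to
  -- exp (- z) exp z.
  expTerm-+ : ∀ x y n → antidiagonal (λ i j → expTerm x i * expTerm y j) n ≈ expTerm (x + y) n
  expTerm-+ x y n = begin-equality
    antidiagonal (λ i j → expTerm x i * expTerm y j) n
      ≈⟨ sum-cong-≋ {suc n} (λ k → binomialTerm-/-! (ℕ.s≤s⁻¹ (Fin.toℕ<n k)) x y) ⟨
    sum {suc n} (λ k → Binomial.binomialTerm commutativeSemiring x y n k * fromℕ (n !) ⁻¹)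
      ≈⟨ *-distribʳ-sum (fromℕ (n !) ⁻¹) (Binomial.binomialTerm commutativeSemiring x y n) ⟨
    Binomial.binomialExpansion commutativeSemiring x y n * fromℕ (n !) ⁻¹
      ≈⟨ *-congʳ (Binomial.theorem commutativeSemiring n x y) ⟨
    expTerm (x + y) n ∎
    where open ≤-Reasoning

  triangle-expTerm : ∀ x y n →
    triangle (λ i j → expTerm x i * expTerm y j) n ≈ expSum (x + y) n
  triangle-expTerm x y n = ∑-cong n (expTerm-+ x y)

  expSum-nonNegative : ∀ {x} → 0# ≤ x → ∀ m → 0# ≤ expSum x m
  expSum-nonNegative 0≤x m = ∑-nonNegative m (expTerm-nonNegative 0≤x)

  expSum-monoʳ-≤ : ∀ {x} → 0# ≤ x → ∀ {m n} → m ℕ.≤ n → expSum x m ≤ expSum x n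
  expSum-monoʳ-≤ 0≤x m≤n = ∑-monoˡ-≤ (expTerm-nonNegative 0≤x) m≤n

  expSum-+-≤ : ∀ {x y} → 0# ≤ x → 0# ≤ y → ∀ n →
               expSum (x + y) n ≤ expSum x n * expSum y n
  expSum-+-≤ {x} {y} 0≤x 0≤y n =
    ≤-respˡ-≈ (triangle-expTerm x y n)
    (≤-respʳ-≈ (rectangle-product (expTerm x) (expTerm y) n n)
    (triangle≤rectangle n n (λ i j → *-nonNegative (expTerm-nonNegative 0≤x i) (expTerm-nonNegative 0≤y j))
                        ℕ.≤-refl))

  expSum-*-≤ : ∀ {x y} → 0# ≤ x → 0# ≤ y → ∀ m n →
               expSum x m * expSum y n ≤ expSum (x + y) (m ℕ.+ n)
  expSum-*-≤ {x} {y} 0≤x 0≤y m n =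
    ≤-respˡ-≈ (rectangle-product (expTerm x) (expTerm y) m n)
    (≤-respʳ-≈ (triangle-expTerm x y (m ℕ.+ n))
    (rectangle≤triangle m n (λ i j →
      *-nonNegative (expTerm-nonNegative 0≤x i) (expTerm-nonNegative 0≤y j))))

  1+x≤expSum : ∀ {x} → 0# ≤ x → ∀ m → 1# + x ≤ expSum x (suc (suc m))
  1+x≤expSum {x} 0≤x m = +-mono-≤ (inj₂ (sym (expTerm-0 x)))
    (≤-respˡ-≈ (+-identityʳ x) (+-mono-≤ (inj₂ (sym (expTerm-1 x)))
      (∑-nonNegative m (λ k → expTerm-nonNegative 0≤x (suc (suc k))))))

  1≤expSum : ∀ {x} → 0# ≤ x → ∀ m → 1# ≤ expSum x (suc m)
  1≤expSum {x} 0≤x m = ≤-respˡ-≈ (+-identityʳ 1#) (+-mono-≤ (inj₂ (sym (expTerm-0 x)))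
    (∑-nonNegative m (λ k → expTerm-nonNegative 0≤x (suc k))))

  -- The recurrence gives (k + 2) times the term on the left, and 2 ≤ k + 2.
  2*expTerm≤ : ∀ {x} → 0# ≤ x → ∀ k →
               (1# + 1#) * expTerm x (suc (suc k)) ≤ x * expTerm x (suc k)
  2*expTerm≤ {x} 0≤x k = ≤-respʳ-≈ (expTerm-suc x (suc k))
    (≤-by (*-nonNegative (0≤fromℕ k) (expTerm-nonNegative 0≤x (suc (suc k))))
      (solve 2 (λ f t → (con (+ 1) :+ (con (+ 1) :+ f)) :* t :- con (+ 2) :* t
                        := f :* t) refl (fromℕ k) (expTerm x (suc (suc k)))))

  -- This is (2 - x) expSum x m ≤ 2 + x, the partial-sum form of
  -- exp x ≤ (2 + x) / (2 - x).
  2*expSum≤ : ∀ {x} → 0# ≤ x → ∀ m →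
              (1# + 1#) * expSum x m ≤ (1# + 1#) + x + x * expSum x m
  2*expSum≤ {x} 0≤x zero = ≤-by (+-nonNegative (+-nonNegative (inj₁ 0<1) (inj₁ 0<1)) 0≤x)
    (solve 1 (λ x → (con (+ 2) :+ x :+ x :* con (+ 0)) :- con (+ 2) :* con (+ 0)
                    := con (+ 2) :+ x) refl x)
  2*expSum≤ {x} 0≤x (suc m) = ≤-by
    (x≤y⇒0≤y-x (tail≤ m))
    (trans (+-cong (+-congˡ (*-congˡ (+-congʳ (expTerm-0 x)))) (-‿cong (*-congˡ (+-congʳ (expTerm-0 x)))))
      (solve 2 (λ x a → (con (+ 2) :+ x :+ x :* (con (+ 1) :+ a))
                          :- con (+ 2) :* (con (+ 1) :+ a)
                        := (con (+ 2) :* x :+ x :* a)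
                          :- con (+ 2) :* a) refl x (tail m)))
    where
    tail : ℕ → Carrier
    tail n = ∑ n (λ k → expTerm x (suc k))

    -- This is the claim after the constant term 1 is removed from the sum. The linear term accounts
    -- for 2x, and twice each later term is at most x times its predecessor.
    tail≤ : ∀ m → (1# + 1#) * tail m ≤ (1# + 1#) * x + x * tail m
    tail≤ zero = ≤-by (*-nonNegative (+-nonNegative (inj₁ 0<1) (inj₁ 0<1)) 0≤x)
      (solve 1 (λ x → (con (+ 2) :* x :+ x :* con (+ 0))
                        :- con (+ 2) :* con (+ 0)
                      := con (+ 2) :* x) refl x)
    tail≤ (suc m) = begin
      (1# + 1#) * (expTerm x 1 + u)        ≈⟨ distribˡ _ _ _ ⟩
      (1# + 1#) * expTerm x 1 + (1# + 1#) * u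
        ≈⟨ +-congˡ (*-distribˡ-sum {m} (1# + 1#) (λ k → expTerm x (suc (suc (toℕ k))))) ⟩
      (1# + 1#) * expTerm x 1 + ∑ m (λ k → (1# + 1#) * expTerm x (suc (suc k)))
        ≤⟨ +-mono-≤ (inj₂ (*-congˡ (expTerm-1 x))) (∑-mono-≤ m (2*expTerm≤ 0≤x)) ⟩
      (1# + 1#) * x + ∑ m (λ k → x * expTerm x (suc k))
        ≈⟨ +-congˡ (*-distribˡ-sum {m} x (λ k → expTerm x (suc (toℕ k)))) ⟨
      (1# + 1#) * x + x * tail m
        ≤⟨ +-mono-≤ ≤-refl (*-monoʳ-≤ 0≤x (∑-monoˡ-≤ (λ k → expTerm-nonNegative 0≤x (suc k)) (ℕ.n≤1+n m))) ⟩
      (1# + 1#) * x + x * tail (suc m) ∎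
      where
      open ≤-Reasoning
      u = ∑ m (λ k → expTerm x (suc (suc k)))

  -- Together these say that (- z)^k has absolute value at most z^k. Both signs are carried because
  -- multiplication by - z exchanges them.
  ^-neg-bounds : ∀ {z} → 0# ≤ z → ∀ k →
                 0# ≤ z ^ k - (- z) ^ k × 0# ≤ z ^ k + (- z) ^ k
  ^-neg-bounds 0≤z zero =
    inj₂ (sym (-‿inverseʳ 1#)) , +-nonNegative (inj₁ 0<1) (inj₁ 0<1)
  ^-neg-bounds {z} 0≤z (suc k) with ^-neg-bounds 0≤z k
  ... | lower , upper =
    ≤-respʳ-≈ (solve 3 (λ z p q → z :* (p :+ q) := z :* p :- (:- z) :* q) refl z _ _)
      (*-nonNegative 0≤z upper) ,
    ≤-respʳ-≈ (solve 3 (λ z p q → z :* (p :- q) := z :* p :+ (:- z) :* q) refl z _ _)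
      (*-nonNegative 0≤z lower)

  expTerm-neg : ∀ {z} → 0# ≤ z → ∀ k → 0# ≤ expTerm z k - expTerm (- z) k
  expTerm-neg {z} 0≤z k = ≤-respʳ-≈
    (solve 3 (λ p q i → (p :- q) :* i := p :* i :- q :* i) refl (z ^ k) ((- z) ^ k) _)
    (*-nonNegative (proj₁ (^-neg-bounds 0≤z k)) (inj₁ (⁻¹-positive (0<fromℕ[k!] k))))

  expSum-0 : ∀ {x} → x ≈ 0# → ∀ m → expSum x m ≤ 1#
  expSum-0 x≈0 zero    = inj₁ 0<1
  expSum-0 {x} x≈0 (suc m) = begin
    expTerm x 0 + ∑ m (λ k → expTerm x (suc k))  ≤⟨ +-mono-≤ (inj₂ (expTerm-0 x)) (∑-mono-≤ m vanish) ⟩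
    1# + ∑ m (λ k → 0# * 0#)                     ≈⟨ +-congˡ (*-distribˡ-sum {m} 0# (λ _ → 0#)) ⟨
    1# + 0# * ∑ m (λ _ → 0#)                     ≈⟨ trans (+-congˡ (zeroˡ _)) (+-identityʳ 1#) ⟩
    1#                                           ∎
    where
    open ≤-Reasoning
    -- Zero is written as a product so that distributivity can pull a factor out of the sum.
    vanish : ∀ k → expTerm x (suc k) ≤ 0# * 0#
    vanish k = inj₂ (begin-equality
      x * x ^ k * _   ≈⟨ *-congʳ (*-congʳ x≈0) ⟩
      0# * x ^ k * _  ≈⟨ solve 2 (λ p i → con (+ 0) :* p :* i := con (+ 0) :* con (+ 0)) refl _ _ ⟩
      0# * 0#         ∎)

  -- The coefficientwise difference of exp z exp z and exp (- z) exp z is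
  -- non-negative, so its triangular partial sums are below its square ones.
  expSum-neg : ∀ {z} → 0# ≤ z → ∀ m →
    expSum (z + z) m ≤ 1# + (expSum z m - expSum (- z) m) * expSum z m
  expSum-neg {z} 0≤z m = begin
    expSum (z + z) m            ≈⟨ triangle-expTerm z z m ⟨
    triangle (λ i j → expTerm z i * expTerm z j) m
      ≈⟨ triangle-+ {c = λ i j → expTerm z i * expTerm z j} m split ⟨
    triangle (λ i j → d i * expTerm z j) m + triangle (λ i j → expTerm (- z) i * expTerm z j) m
      ≤⟨ +-mono-≤ (triangle≤rectangle m m (λ i j →
           *-nonNegative (expTerm-neg 0≤z i) (expTerm-nonNegative 0≤z j)) ℕ.≤-refl)
         (inj₂ (triangle-expTerm (- z) z m)) ⟩
    rectangle (λ i j → d i * expTerm z j) m m + expSum (- z + z) m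
      ≤⟨ +-mono-≤ (inj₂ (rectangle-product d (expTerm z) m m)) (expSum-0 (-‿inverseˡ z) m) ⟩
    ∑ m d * expSum z m + 1#     ≈⟨ +-comm _ 1# ⟩
    1# + ∑ m d * expSum z m     ≈⟨ +-congˡ (*-congʳ ∑d≈) ⟩
    1# + (expSum z m - expSum (- z) m) * expSum z m ∎
    where
    open ≤-Reasoning
    d : ℕ → Carrier
    d i = expTerm z i - expTerm (- z) i
    split : ∀ i j → d i * expTerm z j + expTerm (- z) i * expTerm z j ≈ expTerm z i * expTerm z j
    split i j = solve 3 (λ p q t → (p :- q) :* t :+ q :* t := p :* t) refl _ _ _
    ∑d≈ : ∑ m d ≈ expSum z m - expSum (- z) m
    ∑d≈ = begin-equality
      ∑ m d  ≈⟨ solve 2 (λ s t → s := (s :+ t) :- t) refl _ _ ⟩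
      (∑ m d + expSum (- z) m) - expSum (- z) m  ≈⟨ +-congʳ (∑-+ m d (expTerm (- z))) ⟨
      ∑ m (λ i → d i + expTerm (- z) i) - expSum (- z) m
        ≈⟨ +-congʳ (∑-cong m λ i → solve 2 (λ p q → (p :- q) :+ q := p) refl (expTerm z i) (expTerm (- z) i)) ⟩
      expSum z m - expSum (- z) m ∎

-- The exponential function on x ≥ 0.

module Exponential (em : ExcludedMiddle 0ℓ) (R : RealField) where

  open RealField R
  open Analysis em R
  open OrderedField R
  open Floor em R
  open PartialSums em R
  open IntegerCoefficientSolver commutativeRing
    using (solve; _:=_; _:+_; _:*_; _:-_; :-_; con)
  open SemiringExp semiring using (_^_)

  IsSup : (ℕ → Carrier) → Pred Carrier 0ℓ
  IsSup u l = (∀ m → u m ≤ l) × (∀ {b} → (∀ m → u m ≤ b) → l ≤ b)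

  IsSup-exists : ∀ u {b} → (∀ m → u m ≤ b) → ∃ (IsSup u)
  IsSup-exists u {b} u≤b
    with supremum (λ y → ∃ λ m → y ≈ u m) (u 0 , 0 , refl)
           (b , λ (m , y≈um) → ≤-respˡ-≈ (sym y≈um) (u≤b m))
  ... | l , bound , least =
    l , (λ m → bound (m , refl)) , λ u≤c → least (λ (m , y≈um) → ≤-respˡ-≈ (sym y≈um) (u≤c m))

  IsSup-unique : ∀ {u l l′} → IsSup u l → IsSup u l′ → l ≈ l′
  IsSup-unique (bound , least) (bound′ , least′) = ≤-antisym (least bound′) (least′ bound)

  IsSup-resp-≈ : ∀ {u v l l′} → (∀ m → u m ≈ v m) → l ≈ l′ → IsSup u l → IsSup v l′
  IsSup-resp-≈ u≈v l≈l′ (bound , least) =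
    (λ m → ≤-respˡ-≈ (u≈v m) (≤-respʳ-≈ l≈l′ (bound m))) ,
    (λ v≤b → ≤-respˡ-≈ l≈l′ (least (λ m → ≤-respˡ-≈ (sym (u≈v m)) (v≤b m))))

  IsSup-*-≤ : ∀ {u l c b} → IsSup u l → 0# ≤ c → (∀ m → c * u m ≤ b) → c * l ≤ b
  IsSup-*-≤ {c = c} {b} (_ , least) (inj₁ 0<c) cu≤b =
    ≤-respʳ-≈ cc⁻¹b≈b (*-monoʳ-≤ (inj₁ 0<c)
      (least (λ m → *-cancelˡ-≤ 0<c (≤-respʳ-≈ (sym cc⁻¹b≈b) (cu≤b m)))))
    where
    cc⁻¹b≈b : c * (c ⁻¹ * b) ≈ b
    cc⁻¹b≈b = trans (sym (*-assoc _ _ _)) (trans (*-congʳ (*-⁻¹ 0<c)) (*-identityˡ b))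
  -- The factor can vanish: `exp-+` uses c = `expSum x m`, which is the empty sum at m = 0. Then b
  -- bounds c * u 0 = 0 = c * l.
  IsSup-*-≤ {u} {l} _ (inj₂ 0≈c) cu≤b = ≤-respˡ-≈
    (trans (*-congʳ (sym 0≈c)) (trans (zeroˡ (u 0)) (trans (sym (zeroˡ l)) (*-congʳ 0≈c)))) (cu≤b 0)

  Monotone : Pred (ℕ → Carrier) 0ℓ
  Monotone u = ∀ {m n} → m ℕ.≤ n → u m ≤ u n

  IsSup⇒⟶ : ∀ {u l} → Monotone u → IsSup u l → u ⟶ l
  IsSup⇒⟶ {u} {l} mono (bound , least) ε 0<ε with em {∃ λ N → l - ε < u N}
  ... | yes (N , l-ε<uN) = N , λ m N≤m →
    <-≤-trans l-ε<uN (mono N≤m) ,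
    ≤-<-trans (bound m) (<-by 0<ε (solve 2 (λ l e → (l :+ e) :- l := e) refl l ε))
  ... | no ∄N = contradiction (least below)
    (<⇒≱ (<-by 0<ε (solve 2 (λ l e → l :- (l :- e) := e) refl l ε)))
    where
    below : ∀ m → u m ≤ l - ε
    below m with <-≤-connex (l - ε) (u m)
    ... | inj₁ l-ε<um = contradiction (m , l-ε<um) ∄N
    ... | inj₂ um≤l-ε = um≤l-ε

  -- For an increasing sequence a term above l, or a bound below l, would stay at a fixed distance
  -- from l; that distance is taken as ε.
  ⟶⇒IsSup : ∀ {u l} → Monotone u → u ⟶ l → IsSup u l
  ⟶⇒IsSup {u} {l} mono u⟶l = bound , least
    where
    bound : ∀ m → u m ≤ l
    bound m with <-≤-connex l (u m)
    ... | inj₂ um≤l = um≤l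
    ... | inj₁ l<um with u⟶l (u m - l) (x<y⇒0<y-x l<um)
    ... | N , near = contradiction (mono (ℕ.m≤n+m m N)) (<⇒≱ (<-respʳ-≈
      (solve 2 (λ l v → l :+ (v :- l) := v) refl l (u m))
      (proj₂ (near (N ℕ.+ m) (ℕ.m≤m+n N m)))))

    least : ∀ {b} → (∀ m → u m ≤ b) → l ≤ b
    least {b} u≤b with <-≤-connex b l
    ... | inj₂ l≤b = l≤b
    ... | inj₁ b<l with u⟶l (l - b) (x<y⇒0<y-x b<l)
    ... | N , near = contradiction (u≤b N) (<⇒≱ (<-respˡ-≈
      (solve 2 (λ l b → l :- (l :- b) := b) refl l b)
      (proj₁ (near N ℕ.≤-refl))))

  -- The graph of the exponential function; meaningful on x ≥ 0, where the
  -- partial sums increase.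
  IsExp : Carrier → Pred Carrier 0ℓ
  IsExp x = IsSup (expSum x)

  IsExp-resp-≈ : ∀ {x y a b} → x ≈ y → a ≈ b → IsExp x a → IsExp y b
  IsExp-resp-≈ x≈y = IsSup-resp-≈ (expSum-cong x≈y)

  IsLog⇒IsExp : ∀ {θ x} → 0# ≤ x → IsLog θ x → IsExp x θ
  IsLog⇒IsExp 0≤x = ⟶⇒IsSup (expSum-monoʳ-≤ 0≤x)

  IsExp⇒IsLog : ∀ {θ x} → 0# ≤ x → IsExp x θ → IsLog θ x
  IsExp⇒IsLog 0≤x = IsSup⇒⟶ (expSum-monoʳ-≤ 0≤x)

  1+x≤exp : ∀ {x a} → 0# ≤ x → IsExp x a → 1# + x ≤ a
  1+x≤exp 0≤x (bound , _) = ≤-trans (1+x≤expSum 0≤x 0) (bound 2)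

  1≤exp : ∀ {x a} → 0# ≤ x → IsExp x a → 1# ≤ a
  1≤exp 0≤x (bound , _) = ≤-trans (1≤expSum 0≤x 0) (bound 1)

  0<exp : ∀ {x a} → 0# ≤ x → IsExp x a → 0# < a
  0<exp 0≤x x-exp = <-≤-trans 0<1 (1≤exp 0≤x x-exp)

  2*exp≤ : ∀ {x a} → 0# ≤ x → IsExp x a → (1# + 1#) * a ≤ (1# + 1#) + x + x * a
  2*exp≤ 0≤x x-exp@(bound , _) = IsSup-*-≤ x-exp (+-nonNegative (inj₁ 0<1) (inj₁ 0<1))
    (λ m → ≤-trans (2*expSum≤ 0≤x m) (+-mono-≤ ≤-refl (*-monoʳ-≤ 0≤x (bound m))))

  exp-+ : ∀ {x y a b} → 0# ≤ x → 0# ≤ y → IsExp x a → IsExp y b → IsExp (x + y) (a * b)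
  exp-+ {x} {y} {a} {b} 0≤x 0≤y x-exp@(boundˣ , _) y-exp@(boundʸ , _) = bound , least
    where
    0≤b : 0# ≤ b
    0≤b = inj₁ (0<exp 0≤y y-exp)

    bound : ∀ m → expSum (x + y) m ≤ a * b
    bound m = ≤-trans (expSum-+-≤ 0≤x 0≤y m)
      (*-mono-≤ (expSum-nonNegative 0≤x m) 0≤b (boundˣ m) (boundʸ m))

    -- Two suprema in succession: over n with m fixed, which replaces `expSum y n` by b, and then
    -- over m.
    least : ∀ {c} → (∀ m → expSum (x + y) m ≤ c) → a * b ≤ c
    least {c} S≤c = ≤-respˡ-≈ (*-comm b a) (IsSup-*-≤ x-exp 0≤b λ m →
      ≤-respˡ-≈ (*-comm (expSum x m) b) (IsSup-*-≤ y-exp (expSum-nonNegative 0≤x m) λ n →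
        ≤-trans (expSum-*-≤ 0≤x 0≤y m n) (S≤c (m ℕ.+ n))))

  exp-0 : IsExp 0# 1#
  exp-0 = expSum-0 refl , λ S≤b → ≤-trans (1≤expSum ≤-refl 0) (S≤b 1)

  exp-fromℕ-* : ∀ {x a} → 0# ≤ x → IsExp x a → ∀ n → IsExp (fromℕ n * x) (a ^ n)
  exp-fromℕ-* {x} 0≤x x-exp zero    = IsExp-resp-≈ (sym (zeroˡ x)) refl exp-0
  exp-fromℕ-* {x} 0≤x x-exp (suc n) = IsExp-resp-≈
    (solve 2 (λ x n → x :+ n :* x := (con (+ 1) :+ n) :* x) refl x (fromℕ n)) refl
    (exp-+ 0≤x (*-nonNegative (0≤fromℕ n) 0≤x) x-exp (exp-fromℕ-* 0≤x x-exp n))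

  -- For x ≤ 1 the partial sum s satisfies x s ≤ s, so 2 s ≤ 2 + x + x s gives the bound s ≤ 2 + x.
  exp-exists-≤1 : ∀ {x} → 0# ≤ x → x ≤ 1# → ∃ (IsExp x)
  exp-exists-≤1 {x} 0≤x x≤1 = IsSup-exists (expSum x) λ m → ≤-by
    (+-nonNegative (x≤y⇒0≤y-x (2*expSum≤ 0≤x m))
                   (*-nonNegative (x≤y⇒0≤y-x x≤1) (expSum-nonNegative 0≤x m)))
    (solve 2 (λ x s → (con (+ 2) :+ x) :- s
                      := ((con (+ 2) :+ x :+ x :* s) :- con (+ 2) :* s) :+ (con (+ 1) :- x) :* s)
       refl x (expSum x m))

  *-/-cancel : ∀ {x c} → 0# < c → c * (x / c) ≈ x
  *-/-cancel {x} {c} 0<c = begin-equality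
    c * (x * c ⁻¹)  ≈⟨ solve 3 (λ c x i → c :* (x :* i) := x :* (c :* i)) refl c x _ ⟩
    x * (c * c ⁻¹)  ≈⟨ *-congˡ (*-⁻¹ 0<c) ⟩
    x * 1#          ≈⟨ *-identityʳ x ⟩
    x               ∎
    where open ≤-Reasoning

  /-positive : ∀ {x c} → 0# < x → 0# < c → 0# < x / c
  /-positive 0<x 0<c = *-positive 0<x (⁻¹-positive 0<c)

  /-nonNegative : ∀ {x c} → 0# ≤ x → 0# < c → 0# ≤ x / c
  /-nonNegative 0≤x 0<c = *-nonNegative 0≤x (inj₁ (⁻¹-positive 0<c))

  abstract
    -- With a natural n > x, the argument x/n is at most 1, and exp x is obtained as the n-th power
    -- of exp (x/n).
    exp-exists : ∀ {x} → 0# ≤ x → ∃ (IsExp x)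
    exp-exists {x} 0≤x = a ^ n , IsExp-resp-≈ (*-/-cancel 0<n) refl (exp-fromℕ-* 0≤x/n x/n-exp n)
      where
      n : ℕ
      n = proj₁ (archimedean x)
      x<n : x < fromℕ n
      x<n = proj₂ (archimedean x)
      0<n : 0# < fromℕ n
      0<n = ≤-<-trans 0≤x x<n
      0≤x/n : 0# ≤ x / fromℕ n
      0≤x/n = /-nonNegative 0≤x 0<n
      x/n≤1 : x / fromℕ n ≤ 1#
      x/n≤1 = *-cancelˡ-≤ 0<n (≤-respˡ-≈ (sym (*-/-cancel 0<n))
        (≤-respʳ-≈ (sym (*-identityʳ _)) (inj₁ x<n)))
      x/n-exists : ∃ (IsExp (x / fromℕ n))
      x/n-exists = exp-exists-≤1 0≤x/n x/n≤1
      a : Carrier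
      a = proj₁ x/n-exists
      x/n-exp : IsExp (x / fromℕ n) a
      x/n-exp = proj₂ x/n-exists

  1<exp : ∀ {x a} → 0# < x → IsExp x a → 1# < a
  1<exp {x} 0<x x-exp = <-≤-trans
    (<-by 0<x (solve 1 (λ x → (con (+ 1) :+ x) :- con (+ 1) := x) refl x))
    (1+x≤exp (inj₁ 0<x) x-exp)

  -- By the addition law exp y = exp x exp (y - x), and the last factor exceeds 1.
  exp-mono-< : ∀ {x y a b} → 0# ≤ x → x < y → IsExp x a → IsExp y b → a < b
  exp-mono-< {x} {y} {a} {b} 0≤x x<y x-exp y-exp = begin-strict
    a       ≈⟨ *-identityʳ a ⟨
    a * 1#  <⟨ *-monoʳ-< (0<exp 0≤x x-exp) (1<exp 0<d d-exp) ⟩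
    a * c   ≈⟨ IsSup-unique (IsExp-resp-≈ x+d≈y refl (exp-+ 0≤x (inj₁ 0<d) x-exp d-exp)) y-exp ⟩
    b       ∎
    where
    open ≤-Reasoning
    d = y - x
    0<d : 0# < d
    0<d = x<y⇒0<y-x x<y
    x+d≈y : x + d ≈ y
    x+d≈y = solve 2 (λ x y → x :+ (y :- x) := y) refl x y
    c : Carrier
    c = proj₁ (exp-exists (inj₁ 0<d))
    d-exp : IsExp d c
    d-exp = proj₂ (exp-exists (inj₁ 0<d))

-- Surjectivity of exp and the logarithm.

module Logarithm (em : ExcludedMiddle 0ℓ) (R : RealField) where

  open RealField R
  open Analysis em R
  open OrderedField R
  open Floor em R
  open PartialSums em R
  open Exponential em R
  open IntegerCoefficientSolver commutativeRing
    using (solve; _:=_; _:+_; _:*_; _:-_; :-_; con)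

  -- The witness h = (c - 1) / (c + 1) gives (2 + h) / (2 - h) = (3c + 1) / (c + 3) ≤ c.
  abstract
    exp-near-0 : ∀ {c} → 1# < c → ∃ λ h → ∃ λ b → 0# < h × IsExp h b × b ≤ c
    exp-near-0 {c} 1<c = h , b , 0<h , h-exp , b≤c
      where
      0<c-1 : 0# < c - 1#
      0<c-1 = x<y⇒0<y-x 1<c
      0<c : 0# < c
      0<c = 1<⇒0< 1<c
      0<1+c : 0# < 1# + c
      0<1+c = +-positive (inj₁ 0<1) 0<c
      h : Carrier
      h = (c - 1#) / (1# + c)
      0<h : 0# < h
      0<h = /-positive 0<c-1 0<1+c
      b : Carrier
      b = proj₁ (exp-exists (inj₁ 0<h))
      h-exp : IsExp h b
      h-exp = proj₂ (exp-exists (inj₁ 0<h))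

      -- Multiplying the slack of `2*exp≤` by c + 1 gives (3c + 1) - (c + 3) b, and (c + 3) c - (3c
      -- + 1) = (c - 1)(c + 1).
      difference : ((1# + 1# + 1#) + c) * c - ((1# + 1# + 1#) + c) * b ≈
        (1# + c) * ((1# + 1#) + h + h * b - (1# + 1#) * b) + (c - 1#) * (1# + c)
      difference = begin-equality
        ((1# + 1# + 1#) + c) * c - ((1# + 1# + 1#) + c) * b
          ≈⟨ solve 2 (λ c b →
               (con (+ 3) :+ c) :* c :- (con (+ 3) :+ c) :* b
               := ((con (+ 1) :+ c) :* (con (+ 2) :- con (+ 2) :* b)
                   :+ (c :- con (+ 1)) :* (con (+ 1) :+ b)) :+ (c :- con (+ 1)) :* (con (+ 1) :+ c))
               refl c b ⟩
        ((1# + c) * ((1# + 1#) - (1# + 1#) * b) + (c - 1#) * (1# + b)) + (c - 1#) * (1# + c)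
          ≈⟨ +-congʳ (+-congˡ (*-congʳ (*-/-cancel 0<1+c))) ⟨
        ((1# + c) * ((1# + 1#) - (1# + 1#) * b) + ((1# + c) * h) * (1# + b)) + (c - 1#) * (1# + c)
          ≈⟨ +-congʳ (solve 3 (λ c b h →
               (con (+ 1) :+ c) :* (con (+ 2) :- con (+ 2) :* b)
                 :+ ((con (+ 1) :+ c) :* h) :* (con (+ 1) :+ b)
               := (con (+ 1) :+ c) :* (con (+ 2) :+ h :+ h :* b :- con (+ 2) :* b)) refl c b h) ⟩
        (1# + c) * ((1# + 1#) + h + h * b - (1# + 1#) * b) + (c - 1#) * (1# + c) ∎
        where open ≤-Reasoning

      0<3+c : 0# < (1# + 1# + 1#) + c
      0<3+c = +-positive (+-nonNegative (+-nonNegative (inj₁ 0<1) (inj₁ 0<1)) (inj₁ 0<1)) 0<c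

      b≤c : b ≤ c
      b≤c = *-cancelˡ-≤ 0<3+c (≤-by
        (+-nonNegative (*-nonNegative (inj₁ 0<1+c) (x≤y⇒0≤y-x (2*exp≤ (inj₁ 0<h) h-exp)))
                       (inj₁ (*-positive 0<c-1 0<1+c)))
        difference)

  1</ : ∀ {x y} → 0# < x → x < y → 1# < y / x
  1</ {x} {y} 0<x x<y = *-cancelˡ-< 0<x
    (<-respˡ-≈ (sym (*-identityʳ x)) (<-respʳ-≈ (sym (*-/-cancel 0<x)) x<y))

  x<x+y : ∀ {x y} → 0# < y → x < x + y
  x<x+y {x} {y} 0<y = <-by 0<y (solve 2 (λ x y → (x :+ y) :- x := y) refl x y)

  x-y<x : ∀ {x y} → 0# < y → x - y < x
  x-y<x {x} {y} 0<y = <-by 0<y (solve 2 (λ x y → x :- (x :- y) := y) refl x y)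

  ExpAtMost : Carrier → Pred Carrier 0ℓ
  ExpAtMost θ y = 0# ≤ y × ∃ λ a → IsExp y a × a ≤ θ

  -- There is room to move right: θ/a > 1, so some h > 0 has exp h ≤ θ/a, and exp (s + h) is still
  -- at most θ.
  ExpAtMost-above : ∀ {θ s a} → 0# ≤ s → IsExp s a → a < θ →
                    ∃ λ h → 0# < h × s + h ∈ ExpAtMost θ
  ExpAtMost-above {a = a} 0≤s s-exp a<θ =
    let 0<a = 0<exp 0≤s s-exp
        h , b , 0<h , h-exp , b≤θ/a = exp-near-0 (1</ 0<a a<θ)
    in h , 0<h , +-nonNegative 0≤s (inj₁ 0<h) , a * b , exp-+ 0≤s (inj₁ 0<h) s-exp h-exp ,
       ≤-respʳ-≈ (*-/-cancel 0<a) (*-monoʳ-≤ (inj₁ 0<a) b≤θ/a)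

  -- Here exp h ≤ a/θ. If exp y ≤ θ, then exp (y + h) ≤ a = exp s, so y + h ≤ s by strict
  -- monotonicity.
  ExpAtMost-below : ∀ {θ s a} → 0# ≤ s → IsExp s a → 0# < θ → θ < a →
                    ∃ λ h → 0# < h × UpperBound (ExpAtMost θ) (s - h)
  ExpAtMost-below {θ} {s} {a} 0≤s s-exp 0<θ θ<a =
    let h , b , 0<h , h-exp , b≤a/θ = exp-near-0 (1</ 0<θ θ<a)
    in h , 0<h , λ {y} (0≤y , e , y-exp , e≤θ) → ≤-by
      (x≤y⇒0≤y-x (≮⇒≥ {s} {y + h} (λ s<y+h → <⇒≱
        (exp-mono-< 0≤s s<y+h s-exp (exp-+ 0≤y (inj₁ 0<h) y-exp h-exp))
        (≤-respʳ-≈ (*-/-cancel 0<θ)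
          (*-mono-≤ (inj₁ (0<exp 0≤y y-exp)) (inj₁ (/-positive 0<a 0<θ)) e≤θ b≤a/θ)))))
      (solve 3 (λ s y h → (s :- h) :- y := s :- (y :+ h)) refl s y h)
    where
    0<a : 0# < a
    0<a = <-trans 0<θ θ<a

  exp-sup : ∀ {θ s} → 1# < θ → 0# ≤ s → UpperBound (ExpAtMost θ) s →
            (∀ {u} → UpperBound (ExpAtMost θ) u → s ≤ u) → IsExp s θ
  exp-sup {θ} {s} 1<θ 0≤s bound least =
    let a , s-exp = exp-exists 0≤s
        θ≤a = ≮⇒≥ λ a<θ →
          let h , 0<h , s+h∈ = ExpAtMost-above 0≤s s-exp a<θ in <⇒≱ (x<x+y 0<h) (bound s+h∈)
        a≤θ = ≮⇒≥ λ θ<a →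
          let h , 0<h , s-h-bound = ExpAtMost-below 0≤s s-exp (1<⇒0< 1<θ) θ<a
          in <⇒≱ (x-y<x 0<h) (least s-h-bound)
    in IsExp-resp-≈ refl (≤-antisym a≤θ θ≤a) s-exp

  exp-surjective : ∀ {θ} → 1# < θ → ∃ λ y → 0# ≤ y × IsExp y θ
  exp-surjective {θ} 1<θ =
    let s , bound , least = supremum (ExpAtMost θ) (0# , 0∈) (θ , θ-bound)
        0≤s = bound 0∈
    in s , 0≤s , exp-sup 1<θ 0≤s bound least
    where
    0∈ : 0# ∈ ExpAtMost θ
    0∈ = ≤-refl , 1# , exp-0 , inj₁ 1<θ

    -- From y ≤ 1 + y ≤ exp y ≤ θ.
    θ-bound : UpperBound (ExpAtMost θ) θ
    θ-bound {y} (0≤y , a , y-exp , a≤θ) = ≤-trans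
      (≤-by (inj₁ 0<1) (solve 1 (λ y → (con (+ 1) :+ y) :- y := con (+ 1)) refl y))
      (≤-trans (1+x≤exp 0≤y y-exp) a≤θ)

  -- Suppose y = - z with z ≥ 0, and let b = exp z. The partial sums at y eventually exceed 1, so
  -- `expSum-neg` yields b² = exp (2z) ≤ 1 + (b - 1) b. Hence b ≤ 1 and z = 0, but the partial sums
  -- at 0 never exceed 1.
  IsLog-positive : ∀ {θ y} → 1# < θ → IsLog θ y → 0# < y
  IsLog-positive {θ} {y} 1<θ y-log with <-≤-connex 0# y
  ... | inj₁ 0<y = 0<y
  ... | inj₂ y≤0 = contradiction (expSum-0 y≈0 N) (<⇒≱ (1<expSum N ℕ.≤-refl))
    where
    z = - y
    0≤z : 0# ≤ z
    0≤z = ≤-by (x≤y⇒0≤y-x y≤0) (solve 1 (λ y → (:- y) :- con (+ 0) := con (+ 0) :- y) refl y)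

    -z≈y : - z ≈ y
    -z≈y = solve 1 (λ y → :- (:- y) := y) refl y

    -- With ε = θ - 1 the lower end θ - ε of the neighbourhood is 1.
    limit = y-log (θ - 1#) (x<y⇒0<y-x 1<θ)
    N = proj₁ limit

    1<expSum : ∀ m → N ℕ.≤ m → 1# < expSum y m
    1<expSum m N≤m = <-respˡ-≈ (solve 1 (λ θ → θ :- (θ :- con (+ 1)) := con (+ 1)) refl θ)
      (proj₁ (proj₂ limit m N≤m))

    b : Carrier
    b = proj₁ (exp-exists 0≤z)
    z-exp : IsExp z b
    z-exp = proj₂ (exp-exists 0≤z)

    expSum[2z]≤ : ∀ m → N ℕ.≤ m → expSum (z + z) m ≤ 1# + (b - 1#) * b
    expSum[2z]≤ m N≤m = ≤-trans (expSum-neg 0≤z m) (≤-by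
      (+-nonNegative
        (*-nonNegative (x≤y⇒0≤y-x (1≤exp 0≤z z-exp)) 0≤b-S)
        (*-nonNegative (expSum-nonNegative 0≤z m)
          (+-nonNegative 0≤b-S (inj₁ (x<y⇒0<y-x
            (<-respʳ-≈ (expSum-cong (sym -z≈y) m) (1<expSum m N≤m)))))))
      (solve 3 (λ b S u →
        (con (+ 1) :+ (b :- con (+ 1)) :* b) :- (con (+ 1) :+ (S :- u) :* S)
        := (b :- con (+ 1)) :* (b :- S) :+ S :* ((b :- S) :+ (u :- con (+ 1))))
        refl b (expSum z m) (expSum (- z) m)))
      where
      0≤b-S : 0# ≤ b - expSum z m
      0≤b-S = x≤y⇒0≤y-x (proj₁ z-exp m)

    b*b≤ : b * b ≤ 1# + (b - 1#) * b
    -- The bound is known only from index N on; monotonicity carries it to every m by passing to N +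
    -- m.
    b*b≤ = proj₂ (exp-+ 0≤z 0≤z z-exp z-exp) λ m → ≤-trans
      (expSum-monoʳ-≤ (+-nonNegative 0≤z 0≤z) (ℕ.m≤n+m m N)) (expSum[2z]≤ (N ℕ.+ m) (ℕ.m≤m+n N m))

    b≤1 : b ≤ 1#
    b≤1 = ≤-by (x≤y⇒0≤y-x b*b≤)
      (solve 1 (λ b → con (+ 1) :- b := (con (+ 1) :+ (b :- con (+ 1)) :* b) :- b :* b) refl b)

    z≈0 : z ≈ 0#
    z≈0 with 0≤z
    ... | inj₁ 0<z = contradiction b≤1 (<⇒≱ (1<exp 0<z z-exp))
    ... | inj₂ 0≈z = sym 0≈z

    y≈0 : y ≈ 0#
    y≈0 = trans (sym -z≈y) (trans (-‿cong z≈0) (solve 0 (:- con (+ 0) := con (+ 0)) refl))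

  log-IsLog : ∀ {θ} → 1# < θ → IsLog θ (log θ)
  log-IsLog {θ} 1<θ =
    let y , 0≤y , y-exp = exp-surjective 1<θ
    in choose-satisfies 0# (IsLog θ) (y , IsExp⇒IsLog 0≤y y-exp)

  log-positive : ∀ {θ} → 1# < θ → 0# < log θ
  log-positive 1<θ = IsLog-positive 1<θ (log-IsLog 1<θ)

  log-IsExp : ∀ {θ} → 1# < θ → IsExp (log θ) θ
  log-IsExp 1<θ = IsLog⇒IsExp (inj₁ (log-positive 1<θ)) (log-IsLog 1<θ)

-- Bounds for 1/(exp x - 1), and n-th roots as exponentials.

module Roots (em : ExcludedMiddle 0ℓ) (R : RealField) where

  open RealField R
  open Analysis em R
  open OrderedField R
  open Floor em R
  open Exponential em R
  open Logarithm em R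
  open IntegerCoefficientSolver commutativeRing
    using (solve; _:=_; _:+_; _:*_; _:-_; :-_; con)

  -- 1/x - 1/2 ≤ 1/(eˣ - 1) ≤ 1/x + 1/2, with w = 1/x, v = 1/(eˣ - 1) and h = 1/2.
  reciprocal-bounds : ∀ {x r w v h} → 0# < x → IsExp x r → 0# < h →
    x * w ≈ 1# → (r - 1#) * v ≈ 1# → h + h ≈ 1# → w - h ≤ v × v ≤ w + h
  reciprocal-bounds {x} {r} {w} {v} {h} 0<x x-exp 0<h xw≈1 ρv≈1 h+h≈1 =
    -- Clearing denominators leaves exactly the slack of `2*exp≤` for the lower bound and that of
    -- `1+x≤exp` for v ≤ w; the upper bound then adds h > 0.
    *-cancelˡ-≤ 0<2ρx (≤-by (x≤y⇒0≤y-x (2*exp≤ (inj₁ 0<x) x-exp)) lower) ,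
    ≤-trans (*-cancelˡ-≤ (*-positive 0<ρ 0<x) (≤-by (x≤y⇒0≤y-x (1+x≤exp (inj₁ 0<x) x-exp)) upper))
            (inj₁ (x<x+y 0<h))
    where
    open ≤-Reasoning
    ρ = r - 1#

    0<ρ : 0# < ρ
    0<ρ = x<y⇒0<y-x (1<exp 0<x x-exp)

    0<2ρx : 0# < (1# + 1#) * (ρ * x)
    0<2ρx = *-positive (+-positive (inj₁ 0<1) 0<1) (*-positive 0<ρ 0<x)

    upper : (ρ * x) * w - (ρ * x) * v ≈ r - (1# + x)
    upper = begin-equality
      (ρ * x) * w - (ρ * x) * v
        ≈⟨ solve 4 (λ ρ x w v → (ρ :* x) :* w :- (ρ :* x) :* v
                                := ρ :* (x :* w) :- x :* (ρ :* v)) refl ρ x w v ⟩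
      ρ * (x * w) - x * (ρ * v)
        ≈⟨ +-cong (*-congˡ xw≈1) (-‿cong (*-congˡ ρv≈1)) ⟩
      ρ * 1# - x * 1#
        ≈⟨ solve 2 (λ r x → (r :- con (+ 1)) :* con (+ 1) :- x :* con (+ 1)
                            := r :- (con (+ 1) :+ x)) refl r x ⟩
      r - (1# + x) ∎

    lower : (1# + 1#) * (ρ * x) * v - (1# + 1#) * (ρ * x) * (w - h) ≈
            ((1# + 1#) + x + x * r) - (1# + 1#) * r
    lower = begin-equality
      (1# + 1#) * (ρ * x) * v - (1# + 1#) * (ρ * x) * (w - h)
        ≈⟨ solve 5 (λ ρ x w v h →
             con (+ 2) :* (ρ :* x) :* v :- con (+ 2) :* (ρ :* x) :* (w :- h)
             := con (+ 2) :* x :* (ρ :* v) :- con (+ 2) :* ρ :* (x :* w) :+ ρ :* x :* (h :+ h))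
             refl ρ x w v h ⟩
      (1# + 1#) * x * (ρ * v) - (1# + 1#) * ρ * (x * w) + ρ * x * (h + h)
        ≈⟨ +-cong (+-cong (*-congˡ ρv≈1) (-‿cong (*-congˡ xw≈1))) (*-congˡ h+h≈1) ⟩
      (1# + 1#) * x * 1# - (1# + 1#) * ρ * 1# + ρ * x * 1#
        ≈⟨ solve 2 (λ r x →
             con (+ 2) :* x :* con (+ 1) :- con (+ 2) :* (r :- con (+ 1)) :* con (+ 1)
               :+ (r :- con (+ 1)) :* x :* con (+ 1)
             := (con (+ 2) :+ x :+ x :* r) :- con (+ 2) :* r) refl r x ⟩
      ((1# + 1#) + x + x * r) - (1# + 1#) * r ∎

  0<½ : 0# < ½
  0<½ = /-positive 0<1 (0<fromℕ[1+n] 1)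

  ½+½≈1 : ½ + ½ ≈ 1#
  ½+½≈1 = trans
    (solve 1 (λ h → h :+ h := (con (+ 1) :+ (con (+ 1) :+ con (+ 0))) :* h) refl ½)
    (*-/-cancel (0<fromℕ[1+n] 1))

  module _ {θ : Carrier} (1<θ : 1# < θ) (m : ℕ) where

    private
      n = suc m
      x = log θ / fromℕ n
      r = root n θ

    0<log/n : 0# < x
    0<log/n = /-positive (log-positive 1<θ) (0<fromℕ[1+n] m)

    -- The n-th power of exp (log θ / n) is exp (log θ) = θ, and a positive n-th root is unique, so
    -- it agrees with the chosen one.
    root-IsExp : IsExp x r
    root-IsExp =
      let a , x-exp = exp-exists (inj₁ 0<log/n)
          aⁿ≈θ = IsSup-unique
            (IsExp-resp-≈ (*-/-cancel (0<fromℕ[1+n] m)) refl (exp-fromℕ-* (inj₁ 0<log/n) x-exp n))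
            (log-IsExp 1<θ)
          0<a = 0<exp (inj₁ 0<log/n) x-exp
          0<r , rⁿ≈θ = choose-satisfies 0# (IsRoot n θ) (a , 0<a , aⁿ≈θ)
      in IsExp-resp-≈ refl (^-injective m 0<a 0<r (trans aⁿ≈θ (sym rⁿ≈θ))) x-exp

    root<2 : log₂ θ < fromℕ n → r < fromℕ 2
    root<2 log₂θ<n = exp-mono-< (inj₁ 0<log/n) x<log2 root-IsExp (log-IsExp 1<2)
      where
      1<2 : 1# < fromℕ 2
      1<2 = <-by 0<1 (solve 0
        ((con (+ 1) :+ (con (+ 1) :+ con (+ 0))) :- con (+ 1) := con (+ 1)) refl)
      x<log2 : x < log (fromℕ 2)
      -- After multiplying by n: n x = log θ = log 2 · log₂ θ < log 2 · n.
      x<log2 = *-cancelˡ-< (0<fromℕ[1+n] m)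
        (<-respˡ-≈ (trans (*-/-cancel (log-positive 1<2)) (sym (*-/-cancel (0<fromℕ[1+n] m))))
          (<-respʳ-≈ (*-comm _ _) (*-monoʳ-< (log-positive 1<2) log₂θ<n)))

    frac-root : log₂ θ < fromℕ n → frac r ≈ r - 1#
    frac-root log₂θ<n = +-congˡ (-‿cong (trans (reflexive (≡.cong fromℤ ⌊r⌋≡1)) (+-identityʳ 1#)))
      where
      ⌊r⌋≡1 : ⌊ r ⌋ ≡ + 1
      ⌊r⌋≡1 = ⌊⌋-unique
        ( ≤-respˡ-≈ (sym (+-identityʳ 1#)) (inj₁ (1<exp 0<log/n root-IsExp))
        , <-respʳ-≈ (solve 0 (con (+ 1) :+ (con (+ 1) :+ con (+ 0))
                              := (con (+ 1) :+ con (+ 0)) :+ con (+ 1)) refl) (root<2 log₂θ<n))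

    x*[n/log]≈1 : x * (fromℕ n / log θ) ≈ 1#
    x*[n/log]≈1 = trans
      (solve 4 (λ l n l⁻¹ n⁻¹ → (l :* n⁻¹) :* (n :* l⁻¹) := (l :* l⁻¹) :* (n :* n⁻¹))
        refl (log θ) (fromℕ n) _ _)
      (trans (*-cong (*-⁻¹ (log-positive 1<θ)) (*-⁻¹ (0<fromℕ[1+n] m))) (*-identityˡ 1#))

    M′-bounds : fromℕ n / log θ - ½ ≤ 1# / (r - 1#) × 1# / (r - 1#) ≤ fromℕ n / log θ + ½
    M′-bounds = reciprocal-bounds 0<log/n root-IsExp 0<½ x*[n/log]≈1
      (*-/-cancel (x<y⇒0<y-x (1<exp 0<log/n root-IsExp))) ½+½≈1

-- The dichotomy between typical and atypical n.

theorem1 : (em : ExcludedMiddle 0ℓ) (R : RealField) →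
    let open RealField R
        open Analysis em R
    in (θ : Carrier) → 1# < θ →
       (n : ℕ) → 0 ℕ.< n → log₂ θ < fromℕ n →
       ExactlyOne (M θ n ≡ ⌊ fromℕ n / log θ - ½ ⌋ × n ∉ 𝒜 θ)
                  (M θ n ≡ ⌊ fromℕ n / log θ + ½ ⌋ × n ∈ 𝒜 θ)
theorem1 em R θ 1<θ (suc m) 0<n log₂θ<n = conclude (between-floors {k = k} k-floor t≤v v≤t+1)
  where
  open RealField R
  open Analysis em R
  open OrderedField R
  open Floor em R
  open Exponential em R
  open Logarithm em R
  open Roots em R
  open IntegerCoefficientSolver commutativeRing
    using (solve; _:=_; _:+_; _:-_)

  n = suc m
  t = fromℕ n / log θ - ½
  v = 1# / (root n θ - 1#)

  t+1≈ : t + 1# ≈ fromℕ n / log θ + ½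
  t+1≈ = trans (+-congˡ (sym ½+½≈1))
    (solve 2 (λ w h → (w :- h) :+ (h :+ h) := w :+ h) refl (fromℕ n / log θ) ½)

  t≤v : t ≤ v
  t≤v = proj₁ (M′-bounds 1<θ m)

  v≤t+1 : v ≤ t + 1#
  v≤t+1 = ≤-respʳ-≈ (sym t+1≈) (proj₂ (M′-bounds 1<θ m))

  -- Positivity of v together with v ≤ t + 1 supplies the hypothesis of `floor-exists`.
  0≤t+1 : 0# ≤ t + 1#
  0≤t+1 = ≤-trans (inj₁ (/-positive 0<1 (x<y⇒0<y-x (1<exp (0<log/n 1<θ m) (root-IsExp 1<θ m))))) v≤t+1

  k = proj₁ (floor-exists 0≤t+1)

  k-floor : IsFloor t k
  k-floor = proj₂ (floor-exists 0≤t+1)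

  ⌊t⌋≡k : ⌊ t ⌋ ≡ k
  ⌊t⌋≡k = ⌊⌋-unique k-floor

  ⌊t+1⌋≡1+k : ⌊ fromℕ n / log θ + ½ ⌋ ≡ ℤ.suc k
  ⌊t+1⌋≡1+k = ⌊⌋-unique (IsFloor-resp-≈ {k = ℤ.suc k} t+1≈ (IsFloor-+1 {k = k} k-floor))

  M-floor : ∀ {j} → IsFloor v j → M θ n ≡ j
  M-floor {j} v-floor = ⌊⌋-unique (IsFloor-resp-≈ {k = j}
    (*-congˡ (⁻¹-cong (sym (frac-root 1<θ m log₂θ<n)))) v-floor)

  conclude : IsFloor v k ⊎ IsFloor v (ℤ.suc k) → ExactlyOne
    (M θ n ≡ ⌊ t ⌋ × n ∉ 𝒜 θ) (M θ n ≡ ⌊ fromℕ n / log θ + ½ ⌋ × n ∈ 𝒜 θ)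
  -- In both cases membership in `𝒜 θ` refutes the other alternative.
  conclude (inj₁ v-floor) = inj₁
    ( (≡.trans (M-floor v-floor) (≡.sym ⌊t⌋≡k) , λ (_ , M′≢⌊t⌋) → M′≢⌊t⌋ M′≡⌊t⌋)
    , λ (_ , _ , M′≢⌊t⌋) → M′≢⌊t⌋ M′≡⌊t⌋)
    where
    M′≡⌊t⌋ : M′ θ n ≡ ⌊ t ⌋
    M′≡⌊t⌋ = ≡.trans (⌊⌋-unique v-floor) (≡.sym ⌊t⌋≡k)
  conclude (inj₂ v-floor) = inj₂
    ( (≡.trans (M-floor v-floor) (≡.sym ⌊t+1⌋≡1+k) , n∈𝒜)
    , λ (_ , n∉𝒜) → n∉𝒜 n∈𝒜)
    where
    n∈𝒜 : n ∈ 𝒜 θ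
    -- Since M′ is k + 1 here, equality with ⌊ t ⌋ = k would make k its own successor.
    n∈𝒜 = 0<n , λ M′≡⌊t⌋ → ℤ.i≢suc[i]
      (≡.trans (≡.sym ⌊t⌋≡k) (≡.trans (≡.sym M′≡⌊t⌋) (⌊⌋-unique v-floor)))
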